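{- For every prime $p$ and every integer $n\ge0$, $c_p^{(3)}(n)\,c_p^{(3)}(n+p)\ge 0$; that is, $c_p^{(3)}(n)$ and $c_p^{(3)}(n+p)$ have the same sign.
   Context: For a prime $p$, the coefficients $c_p^{(3)}(n)$ are defined by $\prod_{n\ge1}\frac{(1-q^n)^3}{(1-q^{pn})^3}=\sum_{n\ge0}c_p^{(3)}(n)q^n$. -}

module Defs where

open import Data.Nat as ℕ using (ℕ; zero; suc; _∸_)
open import Data.Nat.Divisibility using (_∣?_)
open import Data.Integer using (ℤ; +_; _+_; _*_; -_)
open import Relation.Nullary.Decidable using (does)
open import Data.Bool using (if_then_else_)

Series : Set
Series = ℕ → ℤ

sumTo : ℕ → (ℕ → ℤ) → ℤ
sumTo zero    f = f 0
sumTo (suc n) f = sumTo n f + f (suc n)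

_⊛_ : Series → Series → Series
(f ⊛ g) n = sumTo n (λ k → f k * g (n ∸ k))

one : Series
one zero    = + 1
one (suc _) = + 0

-- 1 - q^m   (for m ≥ 1)
oneMinusQ : ℕ → Series
oneMinusQ m k = if does (k ℕ.≟ 0) then + 1
                else (if does (k ℕ.≟ m) then - (+ 1) else + 0)

-- 1 / (1 - q^d) = Σ_{j ≥ 0} q^{d j}   (for d ≥ 1)
geomQ : ℕ → Series
geomQ d k = if does (d ∣? k) then + 1 else + 0

cube : Series → Series
cube f = f ⊛ (f ⊛ f)

factor : ℕ → ℕ → Series
factor p m = cube (oneMinusQ m) ⊛ cube (geomQ (p ℕ.* m))

partialProd : ℕ → ℕ → Series
partialProd p zero    = one
partialProd p (suc N) = partialProd p N ⊛ factor p (suc N)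

-- c_p^{(3)}(n): coefficient of q^n in Π_{n≥1} (1-q^n)^3/(1-q^{pn})^3.
-- Factors with m > n are ≡ 1 mod q^{n+1}, so the partial product up to N = n
-- already has the exact coefficient of q^n.
c3 : ℕ → ℕ → ℤ
c3 p n = partialProd p n n

{-# OPTIONS --safe #-}
module Submission where

-- By Jacobi, ∏ (1 - qⁿ)³ = ∑ (-1)ᵐ (2m+1) q^(m(m+1)/2).  Let p = 2h + 1.  The indices m ≡ a and
-- m ≡ -1-a (mod p) have exponents ≡ a(a+1)/2 (mod p), and for a = 0, …, h these residues are distinct
-- because p is prime.  Hence it suffices that, for each a, the part of the sum coming from these
-- indices, divided by (-1)ᵃ q^(a(a+1)/2) ∏ (1 - q^(pn))³, has non-negative coefficients in Q = qᵖ.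
-- For a = h that quotient is p times the cube of ∏ (1 - Q^(pn)) / (1 - Qⁿ).  For a < h put
-- b = 2a + 1, u = h - a, v = u + b, t = Q^p; the part is b ϑ + 2p ϑ′, where ϑ + ϑ′ ε is the triple
-- product at (x , y) = (Q^v (1 + ε) , Q^u (1 - ε)), ε² = 0.  The factor
-- (1 - t^(i+1)) (1 - Q^v tⁱ) (1 - Q^u tⁱ) of ϑ divides ∏ (1 - Qⁿ), and the corresponding ε-part is
-- (1 - t^(i+1)) tⁱ Q^u (1 - Q^b), whose 1 - Q^b is absorbed by another factor of ∏ (1 - Qⁿ)³.
-- For p = 2 the quotient is ∏ (1 - q^(2n-1))³, which has non-negative coefficients in -q.
--
-- Everything is done modulo q^(K+1), so that all sums and products are finite.

open import Level using (Level; 0ℓ; _⊔_)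
open import Algebra.Bundles using (CommutativeMonoid; CommutativeRing; RawRing)
open import Data.Bool.Base using (if_then_else_; true; false)
open import Data.Maybe.Base using (Maybe; just; nothing)
open import Data.Nat using (ℕ)
open import Data.Nat.Base as ℕ using (zero; suc; z≤n; s≤s)
open import Data.Nat.Divisibility using (_∣_; _∣?_; divides; ∣m+n∣m⇒∣n; ∣m∣n⇒∣m+n; ∣-refl; ∣-trans; >⇒∤; _∣0; n∣m*n; ∣n⇒∣m*n)
open import Data.Nat.DivMod using (_%_; _/_; m≡m%n+[m/n]*n; %-distribˡ-+; [m+n]%n≡m%n; %-remove-+ʳ; n%n≡0)
open import Data.Nat.Primality using (Prime; euclidsLemma; prime⇒irreducible)
import Data.Nat.Properties as ℕ
import Data.Nat.Tactic.RingSolver as ℕ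
open import Data.Product.Base using (_,_; _×_; proj₂; ∃-syntax)
open import Data.Sum.Base using (_⊎_; inj₁; inj₂)
open import Function.Bundles using (mk⇔)
open import Relation.Binary.PropositionalEquality as ≡ using (_≡_)
open import Relation.Nullary.Decidable using (does; yes; no; dec-true; dec-false; does-⇔)
open import Relation.Nullary.Negation using (¬_; contradiction)
open import Defs

-- The weight 2m + 1 in Jacobi's series is what calls for dual numbers. On the indices m = pj + a
-- and m = pj + (p - 1 - a) it equals, up to sign, b + 2pk with k = j and k = -(j + 1). The two
-- classes therefore form one bilateral theta series whose weight is linear in k. The part linear in
-- k is a derivative, and the triple product evaluated over the dual numbers yields it without
-- calculus; this is why the identities are stated over an arbitrary commutative ring. Jacobi's
-- identity itself is the same derivative at (x , y) = (q , 1).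
--
-- Non-negative quotients alone would not suffice: they must also be series in Q = q^p, so that each
-- pair of classes occupies a single residue modulo p and the exponents n and n + p meet the same
-- one. For p = 2 the residue of m(m+1)/2 is not determined by that of m, as m = 0 and m = 2 show,
-- hence the separate argument.

private variable c ℓ ℓ′ : Level

-- Finite sums and products in a commutative ring

module Fold (M : CommutativeMonoid c ℓ) where
  open CommutativeMonoid M
  open import Algebra.Properties.CommutativeSemigroup commutativeSemigroup using (interchange)
  open import Relation.Binary.Reasoning.Setoid setoid

  fold : ℕ → (ℕ → Carrier) → Carrier
  fold zero    f = ε
  fold (suc n) f = fold n f ∙ f n

  fold-cong< : ∀ n {f g} → (∀ {i} → i ℕ.< n → f i ≈ g i) → fold n f ≈ fold n g
  fold-cong< zero    e = refl
  fold-cong< (suc n) e = ∙-cong (fold-cong< n λ i<n → e (ℕ.m<n⇒m<1+n i<n)) (e ℕ.≤-refl)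

  fold-cong : ∀ n {f g} → (∀ i → f i ≈ g i) → fold n f ≈ fold n g
  fold-cong n e = fold-cong< n λ {i} _ → e i

  fold-ε : ∀ n → fold n (λ _ → ε) ≈ ε
  fold-ε zero    = refl
  fold-ε (suc n) = trans (∙-congʳ (fold-ε n)) (identityˡ ε)

  fold-∙ : ∀ n f g → fold n (λ i → f i ∙ g i) ≈ fold n f ∙ fold n g
  fold-∙ zero    f g = sym (identityˡ ε)
  fold-∙ (suc n) f g = trans (∙-congʳ (fold-∙ n f g)) (interchange _ _ _ _)

  fold-suc : ∀ n f → fold (suc n) f ≈ f 0 ∙ fold n (λ i → f (suc i))
  fold-suc zero    f = comm ε (f 0)
  fold-suc (suc n) f = trans (∙-congʳ (fold-suc n f)) (assoc _ _ _)

  fold-+ : ∀ m n f → fold (m ℕ.+ n) f ≈ fold m f ∙ fold n (λ i → f (m ℕ.+ i))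
  fold-+ zero    n f = sym (identityˡ _)
  fold-+ (suc m) n f = begin
    fold (suc (m ℕ.+ n)) f                                  ≈⟨ fold-suc (m ℕ.+ n) f ⟩
    f 0 ∙ fold (m ℕ.+ n) (λ i → f (suc i))                  ≈⟨ ∙-congˡ (fold-+ m n _) ⟩
    f 0 ∙ (fold m (λ i → f (suc i)) ∙ fold n (λ i → f (suc m ℕ.+ i))) ≈⟨ assoc _ _ _ ⟨
    f 0 ∙ fold m (λ i → f (suc i)) ∙ fold n (λ i → f (suc m ℕ.+ i)) ≈⟨ ∙-congʳ (fold-suc m f) ⟨
    fold (suc m) f ∙ fold n (λ i → f (suc m ℕ.+ i)) ∎

  fold-swap : ∀ m n (f : ℕ → ℕ → Carrier) →
              fold m (λ i → fold n (f i)) ≈ fold n (λ j → fold m (λ i → f i j))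
  fold-swap zero    n f = sym (fold-ε n)
  fold-swap (suc m) n f = trans (∙-congʳ (fold-swap m n f)) (sym (fold-∙ n _ (f m)))

  fold-blocks : ∀ p n f → fold (p ℕ.* n) f ≈ fold n (λ j → fold p (λ r → f (p ℕ.* j ℕ.+ r)))
  fold-blocks p zero    f = reflexive (≡.cong (λ k → fold k f) (ℕ.*-zeroʳ p))
  fold-blocks p (suc n) f = begin
    fold (p ℕ.* suc n) f     ≡⟨ ≡.cong (λ k → fold k f) (≡.trans (ℕ.*-suc p n) (ℕ.+-comm p _)) ⟩
    fold (p ℕ.* n ℕ.+ p) f   ≈⟨ fold-+ (p ℕ.* n) p f ⟩
    fold (p ℕ.* n) f ∙ fold p (λ r → f (p ℕ.* n ℕ.+ r)) ≈⟨ ∙-congʳ (fold-blocks p n f) ⟩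
    fold (suc n) (λ j → fold p (λ r → f (p ℕ.* j ℕ.+ r))) ∎

  -- With p = 2h + 1 this puts the classes a and -1-a modulo p side by side and leaves the
  -- self-paired class h alone.
  fold-mirror : ∀ h f → fold (suc (2 ℕ.* h)) f ≈
              fold h (λ r → f r ∙ f (2 ℕ.* h ℕ.∸ r)) ∙ f h
  fold-mirror zero    f = refl
  fold-mirror (suc h) f = begin
    fold (suc (2 ℕ.* suc h)) f                        ≡⟨ ≡.cong (λ k → fold (suc k) f) eq ⟩
    fold (suc (suc (2 ℕ.* h))) f ∙ f (suc (suc (2 ℕ.* h))) ≈⟨ ∙-congʳ (fold-suc _ f) ⟩
    f 0 ∙ fold (suc (2 ℕ.* h)) f′ ∙ f (suc (suc (2 ℕ.* h))) ≈⟨ ∙-congʳ (∙-congˡ (fold-mirror h f′)) ⟩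
    f 0 ∙ (fold h (λ r → f′ r ∙ f′ (2 ℕ.* h ℕ.∸ r)) ∙ f (suc h)) ∙ f (suc (suc (2 ℕ.* h)))
      ≈⟨ ∙-congʳ (sym (assoc _ _ _)) ⟩
    f 0 ∙ fold h (λ r → f′ r ∙ f′ (2 ℕ.* h ℕ.∸ r)) ∙ f (suc h) ∙ f (suc (suc (2 ℕ.* h)))
      ≈⟨ assoc _ _ _ ⟩
    (f 0 ∙ fold h (λ r → f′ r ∙ f′ (2 ℕ.* h ℕ.∸ r))) ∙ (f (suc h) ∙ f (suc (suc (2 ℕ.* h))))
      ≈⟨ ∙-congˡ (comm _ _) ⟩
    (f 0 ∙ fold h (λ r → f′ r ∙ f′ (2 ℕ.* h ℕ.∸ r))) ∙ (f (suc (suc (2 ℕ.* h))) ∙ f (suc h))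
      ≈⟨ interchange′ ⟩
    ((f 0 ∙ f (suc (suc (2 ℕ.* h)))) ∙ fold h (λ r → f′ r ∙ f′ (2 ℕ.* h ℕ.∸ r))) ∙ f (suc h)
      ≈⟨ ∙-congʳ (∙-cong (∙-congˡ (reflexive (≡.cong f (≡.sym eq))))
           (fold-cong< h λ {r} r<h → ∙-congˡ (reflexive (≡.cong f (shift r r<h))))) ⟩
    ((f 0 ∙ f (2 ℕ.* suc h)) ∙ fold h (λ r → f (suc r) ∙ f (2 ℕ.* suc h ℕ.∸ suc r))) ∙ f (suc h)
      ≈⟨ ∙-congʳ (fold-suc h _) ⟨
    fold (suc h) (λ r → f r ∙ f (2 ℕ.* suc h ℕ.∸ r)) ∙ f (suc h) ∎
    where
    f′ : ℕ → Carrier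
    f′ i = f (suc i)
    eq : 2 ℕ.* suc h ≡ suc (suc (2 ℕ.* h))
    eq = ≡.cong suc (ℕ.+-suc h (h ℕ.+ 0))
    interchange′ : ∀ {a b d e} → (a ∙ b) ∙ (d ∙ e) ≈ ((a ∙ d) ∙ b) ∙ e
    interchange′ = trans (interchange _ _ _ _) (sym (assoc _ _ _))
    shift : ∀ r → r ℕ.< h → suc (2 ℕ.* h ℕ.∸ r) ≡ 2 ℕ.* suc h ℕ.∸ suc r
    shift r r<h = ≡.trans (≡.sym (ℕ.+-∸-assoc 1 (ℕ.≤-trans (ℕ.<⇒≤ r<h) (ℕ.m≤m+n h _))))
                          (≡.cong (ℕ._∸ suc r) (≡.sym eq))

module Ring (R : CommutativeRing c ℓ) where
  open CommutativeRing R public hiding (zero)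
  open import Algebra.Properties.Ring ring public
    using (-‿involutive; -‿distribˡ-*; -‿distribʳ-*; -0#≈0#; -‿+-comm)
  open import Algebra.Properties.CommutativeSemiring.Exp commutativeSemiring public
  open import Algebra.Properties.Semiring.Mult semiring public
    using (×1-homo-*) renaming (_×_ to _·_; ×-homo-+ to ·-homo-+)
  open import Algebra.Properties.Semiring.Mult.TCOptimised semiring
    using () renaming (_×_ to _×₁_; ×-homo-+ to ×₁-homo-+; ×1-homo-* to ×₁-homo-*)
  open import Relation.Binary.Reasoning.Setoid setoid
  open import Algebra.Solver.Ring.AlmostCommutativeRing
  open import Algebra.Properties.CommutativeSemigroup +-commutativeSemigroup
    using () renaming (interchange to +-interchange)

  -- A difference m - n of naturals as a coefficient; no normal form is needed by the solver.
  private
    differences : RawRing _ _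
    differences = record
      { Carrier = ℕ × ℕ
      ; _≈_ = _≡_
      ; _+_ = λ (a , b) (c , d) → a ℕ.+ c , b ℕ.+ d
      ; _*_ = λ (a , b) (c , d) → a ℕ.* c ℕ.+ b ℕ.* d , a ℕ.* d ℕ.+ b ℕ.* c
      ; -_  = λ (a , b) → b , a
      ; 0#  = 0 , 0
      ; 1#  = 1 , 0
      }

    -- The separate clause for a zero subtrahend makes `(0 , 0)` and `(1 , 0)` evaluate to `0#` and
    -- `1#` themselves, so that solver equations match the terms in which these constants occur.
    ⟦_⟧ : ℕ × ℕ → Carrier
    ⟦ m , zero ⟧      = m ×₁ 1#
    ⟦ m , n@(suc _) ⟧ = m ×₁ 1# - n ×₁ 1#

    unfold : ∀ m n → ⟦ m , n ⟧ ≈ m ×₁ 1# - n ×₁ 1#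
    unfold m zero    = sym (trans (+-congˡ -0#≈0#) (+-identityʳ _))
    unfold m (suc n) = refl

    minus-+ : ∀ a b c d → (a + c) - (b + d) ≈ (a - b) + (c - d)
    minus-+ a b c d = trans (+-congˡ (sym (-‿+-comm b d))) (+-interchange a c (- b) (- d))

    minus-* : ∀ a b c d → (a * c + b * d) - (a * d + b * c) ≈ (a - b) * (c - d)
    minus-* a b c d = sym (begin
      (a - b) * (c - d)                            ≈⟨ distribʳ _ a (- b) ⟩
      a * (c - d) + - b * (c - d)                  ≈⟨ +-cong (distribˡ a c (- d)) (distribˡ (- b) c (- d)) ⟩
      (a * c + a * - d) + (- b * c + - b * - d)    ≈⟨ +-cong (+-congˡ (sym (-‿distribʳ-* a d)))
                                                        (+-cong (sym (-‿distribˡ-* b c))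
                                                          (trans (sym (-‿distribˡ-* b (- d)))
                                                            (trans (-‿cong (sym (-‿distribʳ-* b d))) (-‿involutive _)))) ⟩
      (a * c + - (a * d)) + (- (b * c) + b * d)    ≈⟨ +-congˡ (+-comm _ _) ⟩
      (a * c + - (a * d)) + (b * d + - (b * c))    ≈⟨ minus-+ _ _ _ _ ⟨
      (a * c + b * d) - (a * d + b * c)            ∎)

    morphism : differences -Raw-AlmostCommutative⟶ fromCommutativeRing R
    morphism = record
      { ⟦_⟧ = ⟦_⟧
      ; +-homo = λ (a , b) (c , d) → trans (unfold (a ℕ.+ c) (b ℕ.+ d)) (trans
          (+-cong (×₁-homo-+ 1# a c) (-‿cong (×₁-homo-+ 1# b d)))
          (trans (minus-+ _ _ _ _) (sym (+-cong (unfold a b) (unfold c d)))))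
      ; *-homo = λ (a , b) (c , d) → trans (unfold (a ℕ.* c ℕ.+ b ℕ.* d) (a ℕ.* d ℕ.+ b ℕ.* c)) (trans
          (+-cong (trans (×₁-homo-+ 1# (a ℕ.* c) _) (+-cong (×₁-homo-* a c) (×₁-homo-* b d)))
             (-‿cong (trans (×₁-homo-+ 1# (a ℕ.* d) _) (+-cong (×₁-homo-* a d) (×₁-homo-* b c)))))
          (trans (minus-* _ _ _ _) (sym (*-cong (unfold a b) (unfold c d)))))
      ; -‿homo = λ (a , b) → trans (unfold b a) (sym (trans (-‿cong (unfold a b))
          (trans (sym (-‿+-comm _ _)) (trans (+-congˡ (-‿involutive _)) (+-comm _ _)))))
      ; 0-homo = refl
      ; 1-homo = refl
      }

    decide : ∀ i j → Maybe (⟦ i ⟧ ≈ ⟦ j ⟧)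
    decide (a , b) (c , d) with a ℕ.+ d ℕ.≟ c ℕ.+ b
    ... | no  _  = nothing
    ... | yes eq = just (begin
      ⟦ a , b ⟧                   ≈⟨ unfold a b ⟩
      A - B                       ≈⟨ +-identityʳ _ ⟨
      (A - B) + 0#                ≈⟨ +-congˡ (-‿inverseʳ D) ⟨
      (A - B) + (D - D)           ≈⟨ minus-+ A B D D ⟨
      (A + D) - (B + D)           ≈⟨ +-congʳ (trans (sym (×₁-homo-+ 1# a d)) (trans (reflexive (≡.cong (_×₁ 1#) eq)) (×₁-homo-+ 1# c b))) ⟩
      (C + B) - (B + D)           ≈⟨ +-congˡ (-‿cong (+-comm B D)) ⟩
      (C + B) - (D + B)           ≈⟨ minus-+ C D B B ⟩
      (C - D) + (B - B)           ≈⟨ +-congˡ (-‿inverseʳ B) ⟩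
      (C - D) + 0#                ≈⟨ +-identityʳ _ ⟩
      C - D                       ≈⟨ unfold c d ⟨
      ⟦ c , d ⟧                   ∎)
      where
      A B C D : Carrier
      A = a ×₁ 1#
      B = b ×₁ 1#
      C = c ×₁ 1#
      D = d ×₁ 1#

  open import Algebra.Solver.Ring differences (fromCommutativeRing R) morphism decide public
    using (solve; _:=_; con; _:+_; _:*_; _:-_; :-_; Polynomial)

  :1 : ∀ {n} → Polynomial n
  :1 = con (1 , 0)

  *-1- : ∀ x y → x * (1# - y) ≈ x - y * x
  *-1- = solve 2 (λ x y → x :* (:1 :- y) := x :- y :* x) refl

  cube# : Carrier → Carrier
  cube# x = x * (x * x)

  cube#-cong : ∀ {x y} → x ≈ y → cube# x ≈ cube# y
  cube#-cong e = *-cong e (*-cong e e)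

  cube#-* : ∀ x y → cube# (x * y) ≈ cube# x * cube# y
  cube#-* = solve 2 (λ x y → (x :* y) :* ((x :* y) :* (x :* y)) := (x :* (x :* x)) :* (y :* (y :* y))) refl

  cube#-1 : cube# 1# ≈ 1#
  cube#-1 = trans (*-identityˡ _) (*-identityˡ _)

  open Fold +-commutativeMonoid public renaming
    ( fold to ∑; fold-cong to ∑-cong; fold-ε to ∑-0; fold-∙ to ∑-+
    ; fold-suc to ∑-suc; fold-+ to ∑-split; fold-swap to ∑-swap; fold-blocks to ∑-blocks; fold-mirror to ∑-mirror )
    hiding (fold-cong<)
  open Fold *-commutativeMonoid public renaming
    ( fold to ∏; fold-cong to ∏-cong; fold-ε to ∏-1; fold-∙ to ∏-*
    ; fold-suc to ∏-suc; fold-+ to ∏-split; fold-blocks to ∏-blocks)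
    hiding (fold-cong<; fold-swap; fold-mirror)

  *-∑ : ∀ a n f → a * ∑ n f ≈ ∑ n (λ i → a * f i)
  *-∑ a zero    f = zeroʳ a
  *-∑ a (suc n) f = trans (distribˡ a _ _) (+-congʳ (*-∑ a n f))

  ^-zero-≥ : ∀ {x m n} → x ^ m ≈ 0# → m ℕ.≤ n → x ^ n ≈ 0#
  ^-zero-≥ {x} {m} {n} xᵐ≈0 m≤n = begin
    x ^ n                       ≡⟨ ≡.cong (x ^_) (ℕ.m+[n∸m]≡n m≤n) ⟨
    x ^ (m ℕ.+ (n ℕ.∸ m))       ≈⟨ ^-homo-* x m _ ⟩
    x ^ m * x ^ (n ℕ.∸ m)       ≈⟨ *-congʳ xᵐ≈0 ⟩
    0# * x ^ (n ℕ.∸ m)          ≈⟨ zeroˡ _ ⟩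
    0#                          ∎

  ∏-cube# : ∀ n f → ∏ n (λ i → cube# (f i)) ≈ cube# (∏ n f)
  ∏-cube# n f = trans (∏-* n f _) (*-congˡ (∏-* n f f))

-- Jacobi's triple product identity

module TripleProduct (R : CommutativeRing c ℓ) where
  open Ring R
  open import Relation.Binary.Reasoning.Setoid setoid

  -- (-x)ᵏ t^(k(k-1)/2)
  term : Carrier → Carrier → ℕ → Carrier
  term t x zero    = 1#
  term t x (suc k) = - (x * t ^ k) * term t x k

  term-cong : ∀ t {x y} → x ≈ y → ∀ k → term t x k ≈ term t y k
  term-cong t e zero    = refl
  term-cong t e (suc k) = *-cong (-‿cong (*-congʳ e)) (term-cong t e k)

  term-scale : ∀ t x k → term t (x * t) k ≈ t ^ k * term t x k
  term-scale t x zero    = sym (*-identityˡ 1#)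
  term-scale t x (suc k) = trans (*-congˡ (term-scale t x k))
    (solve 4 (λ x t p a → (:- (x :* t :* p)) :* (p :* a) := (t :* p) :* ((:- (x :* p)) :* a)) refl x t (t ^ k) (term t x k))

  module _ (x y : Carrier) (L : ℕ) (nilpotent : (x * y) ^ L ≈ 0#) where

    private
      -- In the usual notation `x` is z, `y` is q/z and `t` is the nome q. Taking `x` and `y` as the
      -- given data means that nothing has to be inverted.
      t : Carrier
      t = x * y

    t^≈0 : ∀ {i} → L ℕ.≤ i → t ^ i ≈ 0#
    t^≈0 = ^-zero-≥ nilpotent

    1-≈1 : ∀ {z} → z ≈ 0# → 1# - z ≈ 1#
    1-≈1 z≈0 = trans (+-congˡ (trans (-‿cong z≈0) -0#≈0#)) (+-identityʳ 1#)

    term≈0 : ∀ z k → L ℕ.≤ k → term t z (suc k) ≈ 0#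
    term≈0 z k L≤k = trans (*-congʳ (trans (-‿cong (trans (*-congˡ (t^≈0 L≤k)) (zeroʳ z))) -0#≈0#)) (zeroˡ _)

    -- ∏_{i > j} (1 - tⁱ), where the omitted factors are 1 because t is nilpotent
    tail : ℕ → Carrier
    tail j = ∏ L (λ i → 1# - t ^ suc (j ℕ.+ i))

    tail-suc : ∀ j → tail j ≈ (1# - t ^ suc j) * tail (suc j)
    tail-suc j = begin
      tail j                                                    ≈⟨ *-identityʳ _ ⟨
      tail j * 1#                                               ≈⟨ *-congˡ (1-≈1 (t^≈0 (ℕ.≤-trans (ℕ.m≤n+m L j) (ℕ.n≤1+n _)))) ⟨
      ∏ (suc L) (λ i → 1# - t ^ suc (j ℕ.+ i))                  ≈⟨ ∏-suc L _ ⟩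
      (1# - t ^ suc (j ℕ.+ 0)) * ∏ L (λ i → 1# - t ^ suc (j ℕ.+ suc i))
        ≈⟨ *-cong (reflexive (≡.cong (λ k → 1# - t ^ suc k) (ℕ.+-identityʳ j)))
             (∏-cong L λ i → reflexive (≡.cong (λ k → 1# - t ^ suc k) (ℕ.+-suc j i))) ⟩
      (1# - t ^ suc j) * tail (suc j)                           ∎

    tail≈1 : ∀ j → L ℕ.≤ j → tail j ≈ 1#
    tail≈1 j L≤j = trans (∏-cong L λ i → 1-≈1 (t^≈0 (ℕ.≤-trans L≤j (ℕ.≤-trans (ℕ.m≤m+n j i) (ℕ.n≤1+n _))))) (∏-1 L)

    -- Euler's expansion of ∏ (1 - z tⁱ), multiplied by ∏ (1 - tⁱ) over i ≥ 1: the denominators (1 -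
    -- t) ⋯ (1 - tʲ) are cleared and leave `tail j`.
    euler : Carrier → Carrier
    euler z = ∑ (suc L) (λ j → term t z j * tail j)

    -- In the summand of index j + 1 write 1 = t^(j+1) + (1 - t^(j+1)). The first part is a summand
    -- of `euler (z * t)`; in the second, `tail (suc j)` becomes `tail j`, which gives - z times the
    -- preceding summand of `euler (z * t)`.
    euler-step : ∀ z → euler z ≈ (1# - z) * euler (z * t)
    euler-step z = begin
      ∑ (suc L) (λ j → a j * w j)                              ≈⟨ ∑-suc L _ ⟩
      a 0 * w 0 + ∑ L (λ j → a (suc j) * w (suc j))            ≈⟨ +-cong (*-identityˡ _) (∑-cong L λ j → step j) ⟩
      w 0 + ∑ L (λ j → f j + g j)                              ≈⟨ +-congˡ (∑-+ L f g) ⟩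
      w 0 + (∑ L f + ∑ L g)                                    ≈⟨ +-assoc _ _ _ ⟨
      (w 0 + ∑ L f) + ∑ L g                                    ≈⟨ +-cong w+f gs ⟩
      ∑ (suc L) h + ∑ (suc L) g                                ≈⟨ +-congˡ (∑-cong (suc L) g≈) ⟩
      ∑ (suc L) h + ∑ (suc L) (λ j → - z * h j)                ≈⟨ +-congˡ (*-∑ (- z) (suc L) h) ⟨
      ∑ (suc L) h + - z * ∑ (suc L) h                          ≈⟨ solve 2 (λ z s → s :+ (:- z) :* s := (:1 :- z) :* s) refl z _ ⟩
      (1# - z) * euler (z * t)                                 ∎
      where
      a w f g h : ℕ → Carrier
      a = term t z
      w = tail
      h j = term t (z * t) j * w j
      f j = h (suc j)
      g j = a (suc j) * w j
      step : ∀ j → a (suc j) * w (suc j) ≈ f j + g j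
      step j = sym (begin
        term t (z * t) (suc j) * w (suc j) + a (suc j) * w j
          ≈⟨ +-cong (*-congʳ (term-scale t z (suc j))) (*-congˡ (tail-suc j)) ⟩
        t ^ suc j * a (suc j) * w (suc j) + a (suc j) * ((1# - t ^ suc j) * w (suc j))
          ≈⟨ solve 3 (λ p a w → p :* a :* w :+ a :* ((:1 :- p) :* w) := a :* w) refl (t ^ suc j) (a (suc j)) (w (suc j)) ⟩
        a (suc j) * w (suc j) ∎)
      w+f : w 0 + ∑ L f ≈ ∑ (suc L) h
      w+f = trans (+-congʳ (sym (*-identityˡ _))) (sym (∑-suc L h))
      gs : ∑ L g ≈ ∑ (suc L) g
      gs = sym (trans (+-congˡ (trans (*-congʳ (term≈0 z L ℕ.≤-refl)) (zeroˡ _))) (+-identityʳ _))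
      g≈ : ∀ j → g j ≈ - z * h j
      g≈ j = begin
        - (z * t ^ j) * a j * w j       ≈⟨ solve 4 (λ z p a w → (:- (z :* p)) :* a :* w := (:- z) :* ((p :* a) :* w)) refl z (t ^ j) (a j) (w j) ⟩
        - z * ((t ^ j * a j) * w j)     ≈⟨ *-congˡ (*-congʳ (term-scale t z j)) ⟨
        - z * h j                       ∎

    euler-cong : ∀ {z z′} → z ≈ z′ → euler z ≈ euler z′
    euler-cong e = ∑-cong (suc L) λ j → *-congʳ (term-cong t e j)

    euler-0 : euler 0# ≈ tail 0
    euler-0 = begin
      ∑ (suc L) (λ j → term t 0# j * tail j)                       ≈⟨ ∑-suc L _ ⟩
      1# * tail 0 + ∑ L (λ j → term t 0# (suc j) * tail (suc j))   ≈⟨ +-cong (*-identityˡ _) (trans (∑-cong L λ j → vanish j) (∑-0 L)) ⟩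
      tail 0 + 0#                                                  ≈⟨ +-identityʳ _ ⟩
      tail 0                                                       ∎
      where
      vanish : ∀ j → term t 0# (suc j) * tail (suc j) ≈ 0#
      vanish j = solve 3 (λ p a w → (:- (con (0 , 0) :* p)) :* a :* w := con (0 , 0)) refl (t ^ j) (term t 0# j) (tail (suc j))

    euler-iterate : ∀ z n → euler z ≈ ∏ n (λ i → 1# - z * t ^ i) * euler (z * t ^ n)
    euler-iterate z zero    = sym (trans (*-identityˡ _) (euler-cong (*-identityʳ z)))
    euler-iterate z (suc n) = begin
      euler z                                                       ≈⟨ euler-iterate z n ⟩
      ∏ n _ * euler (z * t ^ n)                                     ≈⟨ *-congˡ (euler-step _) ⟩
      ∏ n _ * ((1# - z * t ^ n) * euler (z * t ^ n * t))            ≈⟨ *-assoc _ _ _ ⟨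
      ∏ (suc n) _ * euler (z * t ^ n * t)                           ≈⟨ *-congˡ (euler-cong (solve 3 (λ z p t → z :* p :* t := z :* (t :* p)) refl z (t ^ n) t)) ⟩
      ∏ (suc n) _ * euler (z * t ^ suc n)                           ∎

    -- Once n reaches L the argument z tⁿ is zero, and the iteration ends in `euler 0#`, which is
    -- `tail 0`.
    euler-product : ∀ z n → L ℕ.≤ n → euler z ≈ ∏ n (λ i → 1# - z * t ^ i) * tail 0
    euler-product z n L≤n = trans (euler-iterate z n)
      (*-congˡ (trans (euler-cong (trans (*-congˡ (t^≈0 L≤n)) (zeroʳ z))) euler-0))

    -- Moving the sum by one place multiplies it by 1 - y tᴺ.
    shifted : ℕ → ℕ → Carrier
    shifted zero    j       = term t x j
    shifted (suc N) zero    = - (y * t ^ N) * shifted N zero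
    shifted (suc N) (suc j) = shifted N j

    -- Entry j of `shifted N` is the theta term of index j - N, so consecutive entries have ratio -
    -- x t^(j-N). Multiplying by y t^N and using x y = t removes the negative powers.
    shifted-relation : ∀ N j → - (y * t ^ N) * shifted N (suc j) ≈ t ^ suc j * shifted N j
    shifted-relation zero    j = solve 4 (λ x y p a → (:- (y :* :1)) :* ((:- (x :* p)) :* a) := ((x :* y) :* p) :* a) refl x y (t ^ j) (term t x j)
    shifted-relation (suc N) zero = solve 4 (λ y t p a → (:- (y :* (t :* p))) :* a := (t :* :1) :* ((:- (y :* p)) :* a)) refl y t (t ^ N) (shifted N zero)
    shifted-relation (suc N) (suc j) = begin
      - (y * t ^ suc N) * shifted N (suc j)      ≈⟨ solve 4 (λ y t p a → (:- (y :* (t :* p))) :* a := t :* ((:- (y :* p)) :* a)) refl y t (t ^ N) _ ⟩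
      t * (- (y * t ^ N) * shifted N (suc j))    ≈⟨ *-congˡ (shifted-relation N j) ⟩
      t * (t ^ suc j * shifted N j)              ≈⟨ *-assoc _ _ _ ⟨
      t ^ suc (suc j) * shifted N j              ∎

    partialSum : ℕ → Carrier
    partialSum N = ∑ (N ℕ.+ suc L) (λ j → shifted N j * tail j)

    -- By `tail-suc` and `shifted-relation`, s j * tail (suc j) is s j * tail j plus - z times the
    -- next summand of `partialSum N`. The reindexed sum is thus the old one minus z times itself;
    -- the surplus summand at the upper end contains a power of t beyond L and vanishes.
    partialSum-step : ∀ N → partialSum (suc N) ≈ partialSum N * (1# - y * t ^ N)
    partialSum-step N = begin
      ∑ (suc J) (λ j → shifted (suc N) j * tail j)
        ≈⟨ ∑-suc J _ ⟩
      - z * s 0 * tail 0 + ∑ J (λ j → s j * tail (suc j))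
        ≈⟨ +-congˡ (∑-cong J λ j → split j) ⟩
      - z * s 0 * tail 0 + ∑ J (λ j → s j * tail j + - z * s (suc j) * tail (suc j))
        ≈⟨ +-congˡ (∑-+ J _ _) ⟩
      - z * s 0 * tail 0 + (∑ J (λ j → s j * tail j) + ∑ J (λ j → - z * s (suc j) * tail (suc j)))
        ≈⟨ solve 3 (λ a b c → a :+ (b :+ c) := b :+ (a :+ c)) refl _ _ _ ⟩
      ∑ J (λ j → s j * tail j) + (- z * s 0 * tail 0 + ∑ J (λ j → - z * s (suc j) * tail (suc j)))
        ≈⟨ +-congˡ (∑-suc J _) ⟨
      ∑ J (λ j → s j * tail j) + (∑ J (λ j → - z * s j * tail j) + - z * s J * tail J)
        ≈⟨ +-congˡ (trans (+-congˡ last) (+-identityʳ _)) ⟩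
      ∑ J (λ j → s j * tail j) + ∑ J (λ j → - z * s j * tail j)
        ≈⟨ +-congˡ (trans (∑-cong J λ j → *-assoc _ _ _) (sym (*-∑ (- z) J _))) ⟩
      partialSum N + - z * partialSum N
        ≈⟨ solve 2 (λ z s → s :+ (:- z) :* s := s :* (:1 :- z)) refl z _ ⟩
      partialSum N * (1# - z) ∎
      where
      J : ℕ
      J = N ℕ.+ suc L
      z : Carrier
      z = y * t ^ N
      s : ℕ → Carrier
      s = shifted N
      split : ∀ j → s j * tail (suc j) ≈ s j * tail j + - z * s (suc j) * tail (suc j)
      split j = sym (begin
        s j * tail j + - z * s (suc j) * tail (suc j)
          ≈⟨ +-cong (*-congˡ (tail-suc j)) (*-congʳ (shifted-relation N j)) ⟩
        s j * ((1# - t ^ suc j) * tail (suc j)) + t ^ suc j * s j * tail (suc j)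
          ≈⟨ solve 3 (λ p a w → a :* ((:1 :- p) :* w) :+ p :* a :* w := a :* w) refl (t ^ suc j) (s j) (tail (suc j)) ⟩
        s j * tail (suc j) ∎)
      last : - z * s J * tail J ≈ 0#
      last = trans (*-congʳ (trans (reflexive (≡.cong (λ k → - z * s k) (ℕ.+-suc N L)))
        (trans (shifted-relation N (N ℕ.+ L)) (trans (*-congʳ (t^≈0 (ℕ.≤-trans (ℕ.m≤n+m L N) (ℕ.n≤1+n _)))) (zeroˡ _))))) (zeroˡ _)

    partialSum-product : ∀ n N → L ℕ.≤ n →
      partialSum N ≈ tail 0 * ∏ n (λ i → 1# - x * t ^ i) * ∏ N (λ i → 1# - y * t ^ i)
    partialSum-product n zero    L≤n = trans (euler-product x n L≤n) (trans (*-comm _ _) (sym (*-identityʳ _)))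
    partialSum-product n (suc N) L≤n = trans (partialSum-step N)
      (trans (*-congʳ (partialSum-product n N L≤n)) (*-assoc _ _ _))

    shifted-0 : ∀ N → shifted N 0 ≈ term t y N
    shifted-0 zero    = refl
    shifted-0 (suc N) = *-congˡ (shifted-0 N)

    shifted-∸ : ∀ N j → j ℕ.≤ N → shifted N j ≈ term t y (N ℕ.∸ j)
    shifted-∸ N       zero    _         = shifted-0 N
    shifted-∸ (suc N) (suc j) (s≤s j≤N) = shifted-∸ N j j≤N

    ∑-shifted : ∀ N X → ∑ (N ℕ.+ X) (shifted N) ≈ ∑ X (term t x) + ∑ N (λ m → term t y (suc m))
    ∑-shifted zero    X = sym (+-identityʳ _)
    ∑-shifted (suc N) X = begin
      ∑ (suc (N ℕ.+ X)) (shifted (suc N))                                   ≈⟨ ∑-suc (N ℕ.+ X) _ ⟩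
      shifted (suc N) 0 + ∑ (N ℕ.+ X) (shifted N)                           ≈⟨ +-cong (shifted-0 (suc N)) (∑-shifted N X) ⟩
      term t y (suc N) + (∑ X (term t x) + ∑ N (λ m → term t y (suc m)))    ≈⟨ solve 3 (λ a b c → a :+ (b :+ c) := b :+ (c :+ a)) refl _ _ _ ⟩
      ∑ X (term t x) + ∑ (suc N) (λ m → term t y (suc m))                   ∎

    partialSum≈∑ : ∀ N → suc (L ℕ.+ L) ℕ.≤ N →
      partialSum N ≈ ∑ (suc L) (term t x) + ∑ N (λ m → term t y (suc m))
    partialSum≈∑ N big = trans (∑-cong (N ℕ.+ suc L) drop) (∑-shifted N (suc L))
      where
      drop : ∀ j → shifted N j * tail j ≈ shifted N j
      drop j with ℕ.≤-total L j
      ... | inj₁ L≤j = trans (*-congˡ (tail≈1 j L≤j)) (*-identityʳ _)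
      ... | inj₂ j≤L = trans (*-congʳ s≈0) (trans (zeroˡ _) (sym s≈0))
        where
        1+L≤N∸j : suc L ℕ.≤ N ℕ.∸ j
        1+L≤N∸j = ℕ.≤-trans (ℕ.≤-reflexive (≡.sym (ℕ.m+n∸n≡m (suc L) L))) (ℕ.∸-mono big j≤L)
        j≤N : j ℕ.≤ N
        j≤N = ℕ.≤-trans j≤L (ℕ.≤-trans (ℕ.m≤n+m L (suc L)) big)
        s≈0 : shifted N j ≈ 0#
        s≈0 = trans (shifted-∸ N j j≤N) (trans
          (reflexive (≡.cong (term t y) (≡.sym (ℕ.m+[n∸m]≡n (ℕ.≤-trans (s≤s z≤n) 1+L≤N∸j)))))
          (term≈0 y _ (ℕ.≤-pred (ℕ.≤-trans 1+L≤N∸j (ℕ.≤-reflexive (≡.sym (ℕ.m+[n∸m]≡n (ℕ.≤-trans (s≤s z≤n) 1+L≤N∸j))))))))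

    ∑-extend : ∀ N → suc L ℕ.≤ N → ∑ N (term t x) ≈ ∑ (suc L) (term t x)
    ∑-extend N L<N = begin
      ∑ N (term t x)                                        ≡⟨ ≡.cong (λ k → ∑ k (term t x)) (ℕ.m+[n∸m]≡n L<N) ⟨
      ∑ (suc L ℕ.+ (N ℕ.∸ suc L)) (term t x)                ≈⟨ ∑-split (suc L) _ _ ⟩
      ∑ (suc L) (term t x) + ∑ (N ℕ.∸ suc L) _              ≈⟨ +-congˡ (trans (∑-cong (N ℕ.∸ suc L) λ i → term≈0 x _ (ℕ.m≤m+n L i)) (∑-0 (N ℕ.∸ suc L))) ⟩
      ∑ (suc L) (term t x) + 0#                             ≈⟨ +-identityʳ _ ⟩
      ∑ (suc L) (term t x)                                  ∎

    tail-0 : ∀ N → L ℕ.≤ N → tail 0 ≈ ∏ N (λ i → 1# - t ^ suc i)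
    tail-0 N L≤N = sym (begin
      ∏ N (λ i → 1# - t ^ suc i)                            ≡⟨ ≡.cong (λ k → ∏ k (λ i → 1# - t ^ suc i)) (ℕ.m+[n∸m]≡n L≤N) ⟨
      ∏ (L ℕ.+ (N ℕ.∸ L)) (λ i → 1# - t ^ suc i)            ≈⟨ ∏-split L _ _ ⟩
      tail 0 * ∏ (N ℕ.∸ L) _                                ≈⟨ *-congˡ (trans (∏-cong (N ℕ.∸ L) λ i → 1-≈1 (t^≈0 (ℕ.≤-trans (ℕ.m≤m+n L i) (ℕ.n≤1+n _)))) (∏-1 (N ℕ.∸ L))) ⟩
      tail 0 * 1#                                           ≈⟨ *-identityʳ _ ⟩
      tail 0                                                ∎)

    triple-product : ∀ N → suc (L ℕ.+ L) ℕ.≤ N →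
      ∏ N (λ i → (1# - t ^ suc i) * ((1# - x * t ^ i) * (1# - y * t ^ i)))
        ≈ ∑ N (λ k → term t x k + term t y (suc k))
    triple-product N big = begin
      ∏ N (λ i → (1# - t ^ suc i) * ((1# - x * t ^ i) * (1# - y * t ^ i)))
        ≈⟨ trans (∏-* N _ _) (*-cong (sym (tail-0 N L≤N)) (∏-* N _ _)) ⟩
      tail 0 * (∏ N (λ i → 1# - x * t ^ i) * ∏ N (λ i → 1# - y * t ^ i))
        ≈⟨ *-assoc _ _ _ ⟨
      tail 0 * ∏ N (λ i → 1# - x * t ^ i) * ∏ N (λ i → 1# - y * t ^ i)
        ≈⟨ partialSum-product N N L≤N ⟨
      partialSum N
        ≈⟨ partialSum≈∑ N big ⟩
      ∑ (suc L) (term t x) + ∑ N (λ m → term t y (suc m))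
        ≈⟨ +-congʳ (∑-extend N L<N) ⟨
      ∑ N (term t x) + ∑ N (λ m → term t y (suc m))
        ≈⟨ ∑-+ N _ _ ⟨
      ∑ N (λ k → term t x k + term t y (suc k)) ∎
      where
      L<N : L ℕ.< N
      L<N = ℕ.≤-trans (s≤s (ℕ.m≤m+n L L)) big
      L≤N : L ℕ.≤ N
      L≤N = ℕ.<⇒≤ L<N

-- Dual numbers and the derivative of the triple product.

module Dual (R : CommutativeRing c ℓ) where
  open Ring R

  -- The pair (a , b) is a + b ε with ε² = 0.
  dual : CommutativeRing c ℓ
  dual = record
    { Carrier = Carrier × Carrier
    ; _≈_ = λ (a , b) (c , d) → (a ≈ c) × (b ≈ d)
    ; _+_ = λ (a , b) (c , d) → a + c , b + d
    ; _*_ = λ (a , b) (c , d) → a * c , a * d + b * c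
    ; -_ = λ (a , b) → - a , - b
    ; 0# = 0# , 0#
    ; 1# = 1# , 0#
    ; isCommutativeRing = record
      { isRing = record
        { +-isAbelianGroup = record
          { isGroup = record
            { isMonoid = record
              { isSemigroup = record
                { isMagma = record
                  { isEquivalence = record
                    { refl = refl , refl
                    ; sym = λ (p , q) → sym p , sym q
                    ; trans = λ (p , q) (r , s) → trans p r , trans q s }
                  ; ∙-cong = λ (p , q) (r , s) → +-cong p r , +-cong q s }
                ; assoc = λ (a , b) (c , d) (e , f) → +-assoc a c e , +-assoc b d f }
              ; identity = (λ (a , b) → +-identityˡ a , +-identityˡ b) , (λ (a , b) → +-identityʳ a , +-identityʳ b) }
            ; inverse = (λ (a , b) → -‿inverseˡ a , -‿inverseˡ b) , (λ (a , b) → -‿inverseʳ a , -‿inverseʳ b)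
            ; ⁻¹-cong = λ (p , q) → -‿cong p , -‿cong q }
          ; comm = λ (a , b) (c , d) → +-comm a c , +-comm b d }
        ; *-cong = λ (p , q) (r , s) → *-cong p r , +-cong (*-cong p s) (*-cong q r)
        ; *-assoc = λ (a , b) (c , d) (e , f) → *-assoc a c e ,
            solve 6 (λ a b c d e f → (a :* c) :* f :+ (a :* d :+ b :* c) :* e := a :* (c :* f :+ d :* e) :+ b :* (c :* e)) refl a b c d e f
        ; *-identity = (λ (a , b) → *-identityˡ a , solve 2 (λ a b → :1 :* b :+ con (0 , 0) :* a := b) refl a b)
                     , (λ (a , b) → *-identityʳ a , solve 2 (λ a b → a :* con (0 , 0) :+ b :* :1 := b) refl a b)
        ; distrib = (λ (a , b) (c , d) (e , f) → distribˡ a c e ,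
                       solve 6 (λ a b c d e f → a :* (d :+ f) :+ b :* (c :+ e) := (a :* d :+ b :* c) :+ (a :* f :+ b :* e)) refl a b c d e f)
                  , (λ (a , b) (c , d) (e , f) → distribʳ a c e ,
                       solve 6 (λ a b c d e f → (c :+ e) :* b :+ (d :+ f) :* a := (c :* b :+ d :* a) :+ (e :* b :+ f :* a)) refl a b c d e f) }
      ; *-comm = λ (a , b) (c , d) → *-comm a c ,
          solve 4 (λ a b c d → a :* d :+ b :* c := c :* b :+ d :* a) refl a b c d } }

module TripleProductDerivative (R : CommutativeRing c ℓ) where
  open Ring R
  open TripleProduct R using (term; triple-product)
  private
    module D = Ring (Dual.dual R)
    module DT = TripleProduct (Dual.dual R)

  derivative : ℕ → (ℕ → Carrier) → (ℕ → Carrier) → Carrier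
  derivative zero    f f′ = 0#
  derivative (suc n) f f′ = ∏ n f * f′ n + derivative n f f′ * f n

  ∏-dual : ∀ n f f′ → D.∏ n (λ i → f i , f′ i) D.≈ (∏ n f , derivative n f f′)
  ∏-dual zero    f f′ = refl , refl
  ∏-dual (suc n) f f′ = D.*-congʳ (∏-dual n f f′)

  ∑-dual : ∀ n f f′ → D.∑ n (λ i → f i , f′ i) D.≈ (∑ n f , ∑ n f′)
  ∑-dual zero    f f′ = refl , refl
  ∑-dual (suc n) f f′ = D.+-congʳ (∑-dual n f f′)

  module _ (x y : Carrier) (L : ℕ) (nilpotent : (x * y) ^ L ≈ 0#) where
    private
      t : Carrier
      t = x * y
      -- x (1 + ε) and y (1 - ε), whose product has no ε-part
      x̃ ỹ t̃ : Carrier × Carrier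
      x̃ = x , 1# * x
      ỹ = y , - 1# * y
      t̃ = x̃ D.* ỹ

      t̃^ : ∀ k → t̃ D.^ k D.≈ (t ^ k , 0#)
      t̃^ zero    = refl , refl
      t̃^ (suc k) = D.trans (D.*-congˡ (t̃^ k)) (refl ,
        solve 3 (λ x y p → (x :* y) :* con (0 , 0) :+ (x :* ((:- :1) :* y) :+ (:1 :* x) :* y) :* p := con (0 , 0)) refl x y (t ^ k))

      -- Logarithmic differentiation: (1 + d ε)ᵏ = 1 + k d ε, while `t̃` has no ε-part. Used with d
      -- = 1 for `x̃` and d = -1 for `ỹ`; the latter causes the minus sign in the weighted theta
      -- series.
      dual-term : ∀ d z k → DT.term t̃ (z , d * z) k D.≈ (term t z k , d * (k · 1#) * term t z k)
      dual-term d z zero    = refl , solve 1 (λ d → con (0 , 0) := d :* con (0 , 0) :* :1) refl d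
      dual-term d z (suc k) = D.trans (D.*-cong (D.-‿cong (D.*-congˡ (t̃^ k))) (dual-term d z k)) (refl ,
        solve 5 (λ d z p κ a →
          (:- (z :* p)) :* (d :* κ :* a) :+ (:- (z :* con (0 , 0) :+ d :* z :* p)) :* a
            := d :* (:1 :+ κ) :* ((:- (z :* p)) :* a)) refl d z (t ^ k) (k · 1#) (term t z k))

    -- In the ε-part of (1 - x (1 + ε) tⁱ) (1 - y (1 - ε) tⁱ) the two terms with x y cancel, which
    -- leaves tⁱ (y - x).
    tripleFactor tripleFactor′ : ℕ → Carrier
    tripleFactor  i = (1# - t ^ suc i) * ((1# - x * t ^ i) * (1# - y * t ^ i))
    tripleFactor′ i = (1# - t ^ suc i) * (t ^ i * (y - x))

    triple-product-derivative : ∀ N → suc (L ℕ.+ L) ℕ.≤ N →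
      derivative N tripleFactor tripleFactor′ ≈
        ∑ N (λ k → k · 1# * term t x k - suc k · 1# * term t y (suc k))
    triple-product-derivative N big = proj₂ (D.trans (D.sym lhs) (D.trans (DT.triple-product x̃ ỹ L nil N big) rhs))
      where
      nil : t̃ D.^ L D.≈ D.0#
      nil = D.trans (t̃^ L) (nilpotent , refl)
      lhs : D.∏ N (λ i → (D.1# D.- t̃ D.^ suc i) D.* ((D.1# D.- x̃ D.* t̃ D.^ i) D.* (D.1# D.- ỹ D.* t̃ D.^ i)))
              D.≈ (∏ N tripleFactor , derivative N tripleFactor tripleFactor′)
      lhs = D.trans (D.∏-cong N λ i → D.trans
        (D.*-cong (D.+-congˡ (D.-‿cong (t̃^ (suc i))))
          (D.*-cong (D.+-congˡ (D.-‿cong (D.*-congˡ {x̃} (t̃^ i)))) (D.+-congˡ (D.-‿cong (D.*-congˡ {ỹ} (t̃^ i))))))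
        (refl , solve 4 (λ x y q p →
            let o = con (0 , 0)
                y′ = o :- (y :* o :+ ((:- :1) :* y) :* p)
                x′ = o :- (x :* o :+ (:1 :* x) :* p)
            in (:1 :- q) :* ((:1 :- x :* p) :* y′ :+ x′ :* (:1 :- y :* p))
               :+ (o :- o) :* ((:1 :- x :* p) :* (:1 :- y :* p))
               := (:1 :- q) :* (p :* (y :- x)))
          refl x y (t ^ suc i) (t ^ i))) (∏-dual N tripleFactor tripleFactor′)
      rhs : D.∑ N (λ k → DT.term t̃ x̃ k D.+ DT.term t̃ ỹ (suc k)) D.≈
              (∑ N (λ k → term t x k + term t y (suc k)) , ∑ N (λ k → k · 1# * term t x k - suc k · 1# * term t y (suc k)))
      rhs = D.trans (D.∑-cong N λ k → D.trans (D.+-cong (dual-term 1# x k) (dual-term (- 1#) y (suc k)))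
        (refl , solve 4 (λ κ a κ′ b → :1 :* κ :* a :+ (:- :1) :* κ′ :* b := κ :* a :- κ′ :* b) refl
           (k · 1#) (term t x k) (suc k · 1#) (term t y (suc k)))) (∑-dual N _ _)

-- Triangular numbers along residue classes.

choose₂ : ℕ → ℕ
choose₂ zero    = 0
choose₂ (suc k) = k ℕ.+ choose₂ k

triangle : ℕ → ℕ
triangle k = choose₂ (suc k)

module Triangles where
  open import Data.Nat.Base using (_+_; _*_)
  open ≡.≡-Reasoning

  choose₂-+ : ∀ m n → choose₂ (m + n) ≡ choose₂ m + choose₂ n + m * n
  choose₂-+ zero    n = ≡.sym (ℕ.+-identityʳ _)
  choose₂-+ (suc m) n = ≡.trans (≡.cong (m + n +_) (choose₂-+ m n)) (identity m n (choose₂ m) (choose₂ n))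
    where
    identity : ∀ m n s t → m + n + (s + t + m * n) ≡ m + s + t + suc m * n
    identity = ℕ.solve-∀

  choose₂-even : ∀ u → choose₂ (2 * u) + u ≡ 2 * u * u
  choose₂-even zero    = ≡.refl
  choose₂-even (suc u) = begin
    choose₂ (2 * suc u) + suc u                       ≡⟨ ≡.cong (λ k → choose₂ k + suc u) (double u) ⟩
    suc (2 * u) + (2 * u + choose₂ (2 * u)) + suc u   ≡⟨ regroup u (choose₂ (2 * u)) ⟩
    choose₂ (2 * u) + u + (4 * u + 2)                 ≡⟨ ≡.cong (_+ (4 * u + 2)) (choose₂-even u) ⟩
    2 * u * u + (4 * u + 2)                           ≡⟨ square u ⟩
    2 * suc u * suc u                                 ∎
    where
    double : ∀ u → 2 * suc u ≡ suc (suc (2 * u))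
    double = ℕ.solve-∀
    regroup : ∀ u s → suc (2 * u) + (2 * u + s) + suc u ≡ s + u + (4 * u + 2)
    regroup = ℕ.solve-∀
    square : ∀ u → 2 * u * u + (4 * u + 2) ≡ 2 * suc u * suc u
    square = ℕ.solve-∀

  choose₂-odd : ∀ h → choose₂ (suc (2 * h)) ≡ suc (2 * h) * h
  choose₂-odd h = ≡.trans (regroup h (choose₂ (2 * h))) (≡.trans (≡.cong (_+ h) (choose₂-even h)) (expand h))
    where
    regroup : ∀ h s → 2 * h + s ≡ s + h + h
    regroup = ℕ.solve-∀
    expand : ∀ h → 2 * h * h + h ≡ suc (2 * h) * h
    expand = ℕ.solve-∀

  choose₂-* : ∀ p j → choose₂ (p * j) ≡ p * p * choose₂ j + j * choose₂ p
  choose₂-* p zero = ≡.trans (≡.cong choose₂ (ℕ.*-zeroʳ p)) (vanish p)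
    where
    vanish : ∀ p → 0 ≡ p * p * 0 + 0
    vanish = ℕ.solve-∀
  choose₂-* p (suc j) = begin
    choose₂ (p * suc j)                                       ≡⟨ ≡.cong choose₂ (ℕ.*-suc p j) ⟩
    choose₂ (p + p * j)                                       ≡⟨ choose₂-+ p (p * j) ⟩
    choose₂ p + choose₂ (p * j) + p * (p * j)                 ≡⟨ ≡.cong (λ z → choose₂ p + z + p * (p * j)) (choose₂-* p j) ⟩
    choose₂ p + (p * p * choose₂ j + j * choose₂ p) + p * (p * j) ≡⟨ identity p j (choose₂ p) (choose₂ j) ⟩
    p * p * (j + choose₂ j) + (choose₂ p + j * choose₂ p)     ∎
    where
    identity : ∀ p j s t → s + (p * p * t + j * s) + p * (p * j) ≡ p * p * (j + t) + (s + j * s)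
    identity = ℕ.solve-∀

  -- Because p is odd, `choose₂ p` is the multiple p h of p, so everything beyond `triangle a` is
  -- divisible by p. The cofactor is the exponent of Q in a theta term with x = Q^(h+a+1) and t =
  -- Q^p.
  triangle-class : ∀ h j a → let p = suc (2 * h) in
    triangle (p * j + a) ≡ triangle a + p * ((h + suc a) * j + p * choose₂ j)
  triangle-class h j a = begin
    choose₂ (suc (p * j + a))                              ≡⟨ ≡.cong choose₂ (≡.sym (ℕ.+-suc (p * j) a)) ⟩
    choose₂ (p * j + suc a)                                ≡⟨ choose₂-+ (p * j) (suc a) ⟩
    choose₂ (p * j) + choose₂ (suc a) + p * j * suc a      ≡⟨ ≡.cong (λ z → z + choose₂ (suc a) + p * j * suc a) (choose₂-* p j) ⟩
    p * p * choose₂ j + j * choose₂ p + choose₂ (suc a) + p * j * suc a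
      ≡⟨ ≡.cong (λ z → p * p * choose₂ j + j * z + choose₂ (suc a) + p * j * suc a) (choose₂-odd h) ⟩
    p * p * choose₂ j + j * (p * h) + choose₂ (suc a) + p * j * suc a
      ≡⟨ identity p h j a (choose₂ j) (choose₂ (suc a)) ⟩
    choose₂ (suc a) + p * ((h + suc a) * j + p * choose₂ j) ∎
    where
    p : ℕ
    p = suc (2 * h)
    identity : ∀ p h j a s t → p * p * s + j * (p * h) + t + p * j * suc a ≡ t + p * ((h + suc a) * j + p * s)
    identity = ℕ.solve-∀

  -- With h = u + a the index is pj + (p - 1 - a). The cofactor is that of a theta term with y = Q^u
  -- and index j + 1, so this class supplies the negative half of the bilateral series begun by
  -- `triangle-class`.
  triangle-mirror : ∀ u j a → let p = suc (2 * (u + a)) in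
    triangle (p * j + (2 * u + a)) ≡ triangle a + p * (u * suc j + p * choose₂ (suc j))
  triangle-mirror u j a = begin
    triangle (p * j + (2 * u + a))
      ≡⟨ triangle-class (u + a) j (2 * u + a) ⟩
    choose₂ (suc (2 * u + a)) + p * ((u + a + suc (2 * u + a)) * j + p * choose₂ j)
      ≡⟨ ≡.cong (_+ p * ((u + a + suc (2 * u + a)) * j + p * choose₂ j))
           (≡.trans (≡.cong choose₂ (≡.sym (ℕ.+-suc (2 * u) a))) (choose₂-+ (2 * u) (suc a))) ⟩
    choose₂ (2 * u) + choose₂ (suc a) + 2 * u * suc a + p * ((u + a + suc (2 * u + a)) * j + p * choose₂ j)
      ≡⟨ regroup u a j (choose₂ (2 * u)) (choose₂ (suc a)) (choose₂ j) ⟩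
    choose₂ (suc a) + (choose₂ (2 * u) + u + (2 * a + 1) * u) + p * (u * j + p * (j + choose₂ j))
      ≡⟨ ≡.cong (λ z → choose₂ (suc a) + (z + (2 * a + 1) * u) + p * (u * j + p * (j + choose₂ j))) (choose₂-even u) ⟩
    choose₂ (suc a) + (2 * u * u + (2 * a + 1) * u) + p * (u * j + p * (j + choose₂ j))
      ≡⟨ collect u a j (choose₂ (suc a)) (choose₂ j) ⟩
    choose₂ (suc a) + p * (u * suc j + p * (j + choose₂ j)) ∎
    where
    p : ℕ
    p = suc (2 * (u + a))
    regroup : ∀ u a j s t r → s + t + 2 * u * suc a + suc (2 * (u + a)) * ((u + a + suc (2 * u + a)) * j + suc (2 * (u + a)) * r)
      ≡ t + (s + u + (2 * a + 1) * u) + suc (2 * (u + a)) * (u * j + suc (2 * (u + a)) * (j + r))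
    regroup = ℕ.solve-∀
    collect : ∀ u a j t r → t + (2 * u * u + (2 * a + 1) * u) + suc (2 * (u + a)) * (u * j + suc (2 * (u + a)) * (j + r))
      ≡ t + suc (2 * (u + a)) * (u * suc j + suc (2 * (u + a)) * (j + r))
    collect = ℕ.solve-∀

  -- For a = h the linear coefficient h + (h + 1) equals p, and the exponent collapses to a
  -- triangular number again.
  triangle-centre : ∀ h j → let p = suc (2 * h) in
    triangle (p * j + h) ≡ triangle h + p * (p * triangle j)
  triangle-centre h j = ≡.trans (triangle-class h j h) (identity h j (choose₂ (suc h)) (choose₂ j))
    where
    identity : ∀ h j t r → t + suc (2 * h) * ((h + suc h) * j + suc (2 * h) * r) ≡ t + suc (2 * h) * (suc (2 * h) * (j + r))
    identity = ℕ.solve-∀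

-- Jacobi's identity for the cube of the Euler function.

module Jacobi (R : CommutativeRing c ℓ) where
  open Ring R
  open TripleProduct R
  open TripleProductDerivative R
  open import Relation.Binary.Reasoning.Setoid setoid

  1^ : ∀ n → 1# ^ n ≈ 1#
  1^ zero    = refl
  1^ (suc n) = trans (*-identityˡ _) (1^ n)

  term-closed : ∀ {t s} → t ≈ s → ∀ x k → term t x k ≈ (- 1#) ^ k * (x ^ k * s ^ choose₂ k)
  term-closed         e x zero    = solve 0 (:1 := :1 :* (:1 :* :1)) refl
  term-closed {t} {s} e x (suc k) = begin
    - (x * t ^ k) * term t x k                                          ≈⟨ *-cong (-‿cong (*-congˡ (^-congˡ k e))) (term-closed e x k) ⟩
    - (x * s ^ k) * ((- 1#) ^ k * (x ^ k * s ^ choose₂ k))              ≈⟨ solve 5 (λ x p σ y r → (:- (x :* p)) :* (σ :* (y :* r)) := ((:- :1) :* σ) :* ((x :* y) :* (p :* r))) refl _ _ _ _ _ ⟩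
    (- 1#) ^ suc k * (x ^ suc k * (s ^ k * s ^ choose₂ k))              ≈⟨ *-congˡ (*-congˡ (^-homo-* s k (choose₂ k))) ⟨
    (- 1#) ^ suc k * (x ^ suc k * s ^ choose₂ (suc k))                  ∎

  euler-function : Carrier → ℕ → Carrier
  euler-function q n = ∏ n (λ i → 1# - q ^ suc i)

  jacobi-term : Carrier → ℕ → Carrier
  jacobi-term q k = (- 1#) ^ k * ((k ℕ.+ suc k) · 1# * q ^ triangle k)

  module _ (q : Carrier) (L : ℕ) (q^L≈0 : q ^ L ≈ 0#) where
    private
      E : ℕ → Carrier
      E = euler-function q
      q1^ : ∀ i → (q * 1#) ^ i ≈ q ^ i
      q1^ i = ^-congˡ i (*-identityʳ q)
      nil : (q * 1#) ^ L ≈ 0#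
      nil = trans (q1^ L) q^L≈0
      f f′ : ℕ → Carrier
      f  = tripleFactor q 1# L nil
      f′ = tripleFactor′ q 1# L nil

      f≈ : ∀ i → f i ≈ (1# - q ^ suc i) * ((1# - q * q ^ i) * (1# - q ^ i))
      f≈ i = *-cong (+-congˡ (-‿cong (q1^ (suc i))))
               (*-cong (+-congˡ (-‿cong (*-congˡ (q1^ i)))) (+-congˡ (-‿cong (trans (*-identityˡ _) (q1^ i)))))

      ∏f≈0 : ∀ n → ∏ (suc n) f ≈ 0#
      ∏f≈0 n = trans (∏-suc n f) (trans (*-congʳ (trans (f≈ 0)
        (solve 1 (λ q → (:1 :- q :* :1) :* ((:1 :- q :* :1) :* (:1 :- :1)) := con (0 , 0)) refl q))) (zeroˡ _))

      -- At y = 1 the factor `f 0` is zero, so in the Leibniz rule only the summand that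
      -- differentiates it survives. That summand is (1 - q)² times the remaining factors; in those,
      -- the exponents of the third kind lag by one, whence the single `E n`.
      derivative≈ : ∀ n → derivative (suc n) f f′ ≈ E (suc n) * (E (suc n) * E n)
      derivative≈ zero    = solve 1 (λ q →
        :1 :* ((:1 :- (q :* :1) :* :1) :* (:1 :* (:1 :- q))) :+ con (0 , 0) :* ((:1 :- (q :* :1) :* :1) :* ((:1 :- q :* :1) :* (:1 :- :1 :* :1)))
          := (:1 :* (:1 :- q :* :1)) :* ((:1 :* (:1 :- q :* :1)) :* :1)) refl q
      derivative≈ (suc n) = begin
        ∏ (suc n) f * f′ (suc n) + derivative (suc n) f f′ * f (suc n)
          ≈⟨ +-cong (trans (*-congʳ (∏f≈0 n)) (zeroˡ _)) (*-cong (derivative≈ n) (f≈ (suc n))) ⟩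
        0# + E (suc n) * (E (suc n) * E n) * ((1# - q ^ suc (suc n)) * ((1# - q * q ^ suc n) * (1# - q ^ suc n)))
          ≈⟨ solve 4 (λ e d q p → con (0 , 0) :+ d :* (d :* e) :* ((:1 :- q :* p) :* ((:1 :- q :* p) :* (:1 :- p)))
               := (d :* (:1 :- q :* p)) :* ((d :* (:1 :- q :* p)) :* (e :* (:1 :- p)))) refl (E n) (E (suc n)) q (q ^ suc n) ⟩
        E (suc (suc n)) * (E (suc (suc n)) * E (suc n)) ∎

      -- The term of index k at `q` and the term of index k + 1 at `1#` share the exponent
      -- `triangle k` and have opposite signs, so the weights add up to 2k + 1.
      summand≈ : ∀ k → k · 1# * term (q * 1#) q k - suc k · 1# * term (q * 1#) 1# (suc k) ≈ jacobi-term q k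
      summand≈ k = begin
        k · 1# * term (q * 1#) q k - suc k · 1# * term (q * 1#) 1# (suc k)
          ≈⟨ +-cong (*-congˡ (trans (term-closed (*-identityʳ q) q k) (*-congˡ (sym (^-homo-* q k (choose₂ k))))))
               (-‿cong (*-congˡ (trans (term-closed (*-identityʳ q) 1# (suc k)) (*-congˡ (trans (*-congʳ (1^ (suc k))) (*-identityˡ _)))))) ⟩
        k · 1# * ((- 1#) ^ k * r) - suc k · 1# * ((- 1#) ^ suc k * r)
          ≈⟨ solve 4 (λ κ σ r κ′ → κ :* (σ :* r) :- κ′ :* (((:- :1) :* σ) :* r) := σ :* ((κ :+ κ′) :* r)) refl (k · 1#) ((- 1#) ^ k) r (suc k · 1#) ⟩
        (- 1#) ^ k * ((k · 1# + suc k · 1#) * r)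
          ≈⟨ *-congˡ (*-congʳ (·-homo-+ 1# k (suc k))) ⟨
        jacobi-term q k ∎
        where
        r : Carrier
        r = q ^ triangle k

    jacobi : ∀ N → suc (L ℕ.+ L) ℕ.≤ N → E N * (E N * E N) ≈ ∑ N (jacobi-term q)
    jacobi (suc n) (s≤s big) = begin
      -- The factor 1 - q^(n+1) is 1 because n ≥ L, so the lagging `E n` completes the cube.
      E (suc n) * (E (suc n) * E (suc n))     ≈⟨ *-congˡ (*-congˡ (trans (*-congˡ (1-≈1 q 1# L nil (^-zero-≥ q^L≈0 (ℕ.m≤n⇒m≤1+n (ℕ.≤-trans (ℕ.m≤m+n L L) big))))) (*-identityʳ _))) ⟩
      E (suc n) * (E (suc n) * E n)           ≈⟨ derivative≈ n ⟨
      derivative (suc n) f f′                 ≈⟨ triple-product-derivative q 1# L nil (suc n) (s≤s big) ⟩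
      _                                       ≈⟨ ∑-cong (suc n) summand≈ ⟩
      ∑ (suc n) (jacobi-term q)               ∎

-- Dissection modulo p

-- A subsemiring. It is kept abstract because two kinds of positivity occur: non-negative series in
-- q^p for odd p, and series with non-negative coefficients in -q for p = 2.
record IsCone (R : CommutativeRing c ℓ) (P : CommutativeRing.Carrier R → Set ℓ′) : Set (c ⊔ ℓ ⊔ ℓ′) where
  open CommutativeRing R
  field
    resp : ∀ {x y} → x ≈ y → P x → P y
    P0   : P 0#
    P1   : P 1#
    P+   : ∀ {x y} → P x → P y → P (x + y)
    P*   : ∀ {x y} → P x → P y → P (x * y)

module Cone (R : CommutativeRing c ℓ) {P : CommutativeRing.Carrier R → Set ℓ′} (isCone : IsCone R P) where
  open Ring R
  open IsCone isCone public

  P^ : ∀ {x} n → P x → P (x ^ n)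
  P^ zero    px = P1
  P^ (suc n) px = P* px (P^ n px)

  P-· : ∀ {x} n → P x → P (n · x)
  P-· zero    px = P0
  P-· (suc n) px = P+ px (P-· n px)

  P∏ : ∀ n {f} → (∀ i → P (f i)) → P (∏ n f)
  P∏ zero    pf = P1
  P∏ (suc n) pf = P* (P∏ n pf) (pf n)

module Dissection (R : CommutativeRing c ℓ) (q : CommutativeRing.Carrier R) where
  open Ring R
  open TripleProduct R using (term)
  open Jacobi R
  open Triangles
  open import Relation.Binary.Reasoning.Setoid setoid

  -1*-1 : - 1# * - 1# ≈ 1#
  -1*-1 = solve 0 ((:- :1) :* (:- :1) := :1) refl

  sign-even : ∀ m → (- 1#) ^ (2 ℕ.* m) ≈ 1#
  sign-even m = trans (sym (^-assocʳ (- 1#) 2 m)) (trans (^-congˡ m (trans (*-congˡ (*-identityʳ _)) -1*-1)) (1^ m))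

  sign-odd-* : ∀ h j → (- 1#) ^ (suc (2 ℕ.* h) ℕ.* j) ≈ (- 1#) ^ j
  sign-odd-* h j = trans (sym (^-assocʳ (- 1#) (suc (2 ℕ.* h)) j)) (^-congˡ j (trans (*-congˡ (sign-even h)) (*-identityʳ _)))

  ·1-+ : ∀ m n → (m ℕ.+ n) · 1# ≈ m · 1# + n · 1#
  ·1-+ = ·-homo-+ 1#

  ·1-* : ∀ m n → (m ℕ.* n) · 1# ≈ m · 1# * n · 1#
  ·1-* = ×1-homo-*

  module Class (h : ℕ) where
    p : ℕ
    p = suc (2 ℕ.* h)
    Q : Carrier
    Q = q ^ p

    term-Q : ∀ {t} → t ≈ Q ^ p → ∀ w k → term t (Q ^ w) k ≈ (- 1#) ^ k * q ^ (p ℕ.* (w ℕ.* k ℕ.+ p ℕ.* choose₂ k))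
    term-Q e w k = trans (term-closed e (Q ^ w) k) (*-congˡ (begin
      (Q ^ w) ^ k * (Q ^ p) ^ choose₂ k                     ≈⟨ *-cong (^-assocʳ Q w k) (^-assocʳ Q p (choose₂ k)) ⟩
      Q ^ (w ℕ.* k) * Q ^ (p ℕ.* choose₂ k)                 ≈⟨ ^-homo-* Q (w ℕ.* k) (p ℕ.* choose₂ k) ⟨
      Q ^ (w ℕ.* k ℕ.+ p ℕ.* choose₂ k)                     ≈⟨ ^-assocʳ q p (w ℕ.* k ℕ.+ p ℕ.* choose₂ k) ⟩
      q ^ (p ℕ.* (w ℕ.* k ℕ.+ p ℕ.* choose₂ k))             ∎))

    -- For m = pj + h the weight 2m + 1 is p (2j + 1) and the exponent is `triangle h` plus p²
    -- `triangle j`: the class h reproduces Jacobi's series in Q^p.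
    jacobi-centre : ∀ j → jacobi-term q (p ℕ.* j ℕ.+ h) ≈
                    (- 1#) ^ h * q ^ triangle h * (p · 1# * jacobi-term (Q ^ p) j)
    jacobi-centre j = begin
      (- 1#) ^ m * ((m ℕ.+ suc m) · 1# * q ^ triangle m)
        ≈⟨ *-cong (trans (^-homo-* (- 1#) (p ℕ.* j) h) (*-congʳ (sign-odd-* h j)))
             (*-cong (trans (reflexive (≡.cong (_· 1#) (coefficient h j))) (·1-* p (j ℕ.+ suc j)))
               (trans (reflexive (≡.cong (q ^_) (triangle-centre h j))) (^-homo-* q (triangle h) (p ℕ.* (p ℕ.* triangle j))))) ⟩
      ((- 1#) ^ j * (- 1#) ^ h) * ((p · 1# * (j ℕ.+ suc j) · 1#) * (q ^ triangle h * q ^ (p ℕ.* (p ℕ.* triangle j))))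
        ≈⟨ *-congˡ (*-congˡ (*-congˡ (trans (^-congˡ (triangle j) (^-assocʳ q p p)) (trans (^-assocʳ q (p ℕ.* p) (triangle j)) (reflexive (≡.cong (q ^_) (ℕ.*-assoc p p (triangle j)))))))) ⟨
      ((- 1#) ^ j * (- 1#) ^ h) * ((p · 1# * (j ℕ.+ suc j) · 1#) * (q ^ triangle h * (Q ^ p) ^ triangle j))
        ≈⟨ solve 6 (λ σ τ π κ x y → (σ :* τ) :* ((π :* κ) :* (x :* y)) := (τ :* x) :* (π :* (σ :* (κ :* y)))) refl _ _ _ _ _ _ ⟩
      (- 1#) ^ h * q ^ triangle h * (p · 1# * jacobi-term (Q ^ p) j) ∎
      where
      m : ℕ
      m = p ℕ.* j ℕ.+ h
      coefficient : ∀ h j → let m = suc (2 ℕ.* h) ℕ.* j ℕ.+ h in m ℕ.+ suc m ≡ suc (2 ℕ.* h) ℕ.* (j ℕ.+ suc j)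
      coefficient = ℕ.solve-∀

  module Pair (u a : ℕ) where
    open Class (u ℕ.+ a)
    b v : ℕ
    b = suc (2 ℕ.* a)
    v = u ℕ.+ b
    X Y : Carrier
    X = Q ^ v
    Y = Q ^ u

    v+u≡p : v ℕ.+ u ≡ p
    v+u≡p = identity u a
      where
      identity : ∀ u a → u ℕ.+ suc (2 ℕ.* a) ℕ.+ u ≡ suc (2 ℕ.* (u ℕ.+ a))
      identity = ℕ.solve-∀

    XY≈ : X * Y ≈ Q ^ p
    XY≈ = trans (sym (^-homo-* Q v u)) (reflexive (≡.cong (Q ^_) v+u≡p))

    α β : ℕ → Carrier
    α = term (X * Y) X
    β = term (X * Y) Y

    jacobi-left : ∀ j → jacobi-term q (p ℕ.* j ℕ.+ a) ≈
      (- 1#) ^ a * q ^ triangle a * ((b · 1# + (2 ℕ.* p) · 1# * j · 1#) * α j)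
    jacobi-left j = begin
      (- 1#) ^ m * ((m ℕ.+ suc m) · 1# * q ^ triangle m)
        ≈⟨ *-cong (trans (^-homo-* (- 1#) (p ℕ.* j) a) (*-congʳ (sign-odd-* (u ℕ.+ a) j)))
             (*-cong (trans (reflexive (≡.cong (_· 1#) (coefficient p j a))) (trans (·1-+ b (2 ℕ.* p ℕ.* j)) (+-congˡ (·1-* (2 ℕ.* p) j))))
               (trans (reflexive (≡.cong (q ^_) (≡.trans (triangle-class (u ℕ.+ a) j a)
                   (≡.cong (λ w → triangle a ℕ.+ p ℕ.* (w ℕ.* j ℕ.+ p ℕ.* choose₂ j)) (exponent u a)))))
                 (^-homo-* q (triangle a) (p ℕ.* (v ℕ.* j ℕ.+ p ℕ.* choose₂ j))))) ⟩
      ((- 1#) ^ j * (- 1#) ^ a) * (κ * (q ^ triangle a * q ^ (p ℕ.* (v ℕ.* j ℕ.+ p ℕ.* choose₂ j))))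
        ≈⟨ solve 5 (λ σ τ κ x y → (σ :* τ) :* (κ :* (x :* y)) := (τ :* x) :* (κ :* (σ :* y))) refl _ _ _ _ _ ⟩
      (- 1#) ^ a * q ^ triangle a * (κ * ((- 1#) ^ j * q ^ (p ℕ.* (v ℕ.* j ℕ.+ p ℕ.* choose₂ j))))
        ≈⟨ *-congˡ (*-congˡ (term-Q XY≈ v j)) ⟨
      (- 1#) ^ a * q ^ triangle a * (κ * α j) ∎
      where
      m : ℕ
      m = p ℕ.* j ℕ.+ a
      κ : Carrier
      κ = b · 1# + (2 ℕ.* p) · 1# * j · 1#
      coefficient : ∀ p j a → let m = p ℕ.* j ℕ.+ a in m ℕ.+ suc m ≡ suc (2 ℕ.* a) ℕ.+ 2 ℕ.* p ℕ.* j
      coefficient = ℕ.solve-∀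
      exponent : ∀ u a → u ℕ.+ a ℕ.+ suc a ≡ u ℕ.+ suc (2 ℕ.* a)
      exponent = ℕ.solve-∀

    -- Here 2m + 1 = 2p (j + 1) - b, and (-1)ᵐ has the sign opposite to (-1)ᵃ (-1)^(j+1). The two
    -- reversals combine to the weight b + 2pk of `jacobi-left` at k = -(j + 1).
    jacobi-right : ∀ j → jacobi-term q (p ℕ.* j ℕ.+ (2 ℕ.* u ℕ.+ a)) ≈
      (- 1#) ^ a * q ^ triangle a * ((b · 1# - (2 ℕ.* p) · 1# * suc j · 1#) * β (suc j))
    jacobi-right j = begin
      (- 1#) ^ m * ((m ℕ.+ suc m) · 1# * q ^ triangle m)
        ≈⟨ *-cong (trans (^-homo-* (- 1#) (p ℕ.* j) (2 ℕ.* u ℕ.+ a)) (*-cong (sign-odd-* (u ℕ.+ a) j)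
               (trans (^-homo-* (- 1#) (2 ℕ.* u) a) (trans (*-congʳ (sign-even u)) (*-identityˡ _)))))
             (*-congˡ (trans (reflexive (≡.cong (q ^_) (triangle-mirror u j a))) (^-homo-* q (triangle a) (p ℕ.* (u ℕ.* suc j ℕ.+ p ℕ.* choose₂ (suc j)))))) ⟩
      ((- 1#) ^ j * (- 1#) ^ a) * ((m ℕ.+ suc m) · 1# * (q ^ triangle a * r))
        -- Writing κ as - (b - (κ + b)) moves the minus sign into (-1)^(j+1) and leaves κ + b, which
        -- is 2p (j + 1) already among the naturals.
        ≈⟨ solve 6 (λ σ τ κ x y β → (σ :* τ) :* (κ :* (x :* y)) := (τ :* x) :* ((β :- (κ :+ β)) :* (((:- :1) :* σ) :* y))) refl
             ((- 1#) ^ j) ((- 1#) ^ a) ((m ℕ.+ suc m) · 1#) (q ^ triangle a) r (b · 1#) ⟩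
      (- 1#) ^ a * q ^ triangle a * ((b · 1# - ((m ℕ.+ suc m) · 1# + b · 1#)) * ((- 1#) ^ suc j * r))
        ≈⟨ *-congˡ (*-cong (+-congˡ (-‿cong (trans (sym (·1-+ (m ℕ.+ suc m) b))
             (trans (reflexive (≡.cong (_· 1#) (coefficient u j a))) (·1-* (2 ℕ.* p) (suc j)))))) (sym (term-Q XY≈ u (suc j)))) ⟩
      (- 1#) ^ a * q ^ triangle a * ((b · 1# - (2 ℕ.* p) · 1# * suc j · 1#) * β (suc j)) ∎
      where
      m : ℕ
      m = p ℕ.* j ℕ.+ (2 ℕ.* u ℕ.+ a)
      r : Carrier
      r = q ^ (p ℕ.* (u ℕ.* suc j ℕ.+ p ℕ.* choose₂ (suc j)))
      coefficient : ∀ u j a → let p = suc (2 ℕ.* (u ℕ.+ a)); m = p ℕ.* j ℕ.+ (2 ℕ.* u ℕ.+ a) in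
        m ℕ.+ suc m ℕ.+ suc (2 ℕ.* a) ≡ 2 ℕ.* p ℕ.* suc j
      coefficient = ℕ.solve-∀

    class-sum : ∀ n → ∑ n (λ j → jacobi-term q (p ℕ.* j ℕ.+ a) + jacobi-term q (p ℕ.* j ℕ.+ (2 ℕ.* u ℕ.+ a))) ≈
      (- 1#) ^ a * q ^ triangle a * (b · 1# * ∑ n (λ j → α j + β (suc j)) + (2 ℕ.* p) · 1# * ∑ n (λ j → j · 1# * α j - suc j · 1# * β (suc j)))
    class-sum n = sym (begin
      s * (b · 1# * ∑ n _ + (2 ℕ.* p) · 1# * ∑ n _)
        ≈⟨ *-congˡ (trans (+-cong (*-∑ (b · 1#) n _) (*-∑ ((2 ℕ.* p) · 1#) n _)) (sym (∑-+ n _ _))) ⟩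
      s * ∑ n (λ j → b · 1# * (α j + β (suc j)) + (2 ℕ.* p) · 1# * (j · 1# * α j - suc j · 1# * β (suc j)))
        ≈⟨ *-∑ s n _ ⟩
      ∑ n (λ j → s * (b · 1# * (α j + β (suc j)) + (2 ℕ.* p) · 1# * (j · 1# * α j - suc j · 1# * β (suc j))))
        ≈⟨ ∑-cong n (λ j → trans
             (solve 7 (λ s b π j j′ α β → s :* (b :* (α :+ β) :+ π :* (j :* α :- j′ :* β)) := s :* ((b :+ π :* j) :* α) :+ s :* ((b :- π :* j′) :* β)) refl
                s (b · 1#) ((2 ℕ.* p) · 1#) (j · 1#) (suc j · 1#) (α j) (β (suc j)))
             (sym (+-cong (jacobi-left j) (jacobi-right j)))) ⟩
      ∑ n (λ j → jacobi-term q (p ℕ.* j ℕ.+ a) + jacobi-term q (p ℕ.* j ℕ.+ (2 ℕ.* u ℕ.+ a))) ∎)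
      where
      s : Carrier
      s = (- 1#) ^ a * q ^ triangle a

-- Positivity of the quotients.

module Positivity (R : CommutativeRing c ℓ) {P : CommutativeRing.Carrier R → Set ℓ′} (isCone : IsCone R P) where
  open Ring R
  open Cone R isCone
  open TripleProduct R using (term; triple-product)
  open TripleProductDerivative R
  open Jacobi R
  open import Relation.Binary.Reasoning.Setoid setoid

  module Quotient (Q : Carrier) (PQ : P Q) (g : ℕ → Carrier) (Pg : ∀ m → P (g m))
                  (inverse : ∀ m → g m * (1# - Q ^ suc m) ≈ 1#) where

    -- Given `inverse`, this is the product of 1 / (1 - Q^e) over s < e ≤ s + m.
    chain : ℕ → ℕ → Carrier
    chain s m = ∏ m (λ r → g (s ℕ.+ r))

    P-chain : ∀ s m → P (chain s m)
    P-chain s m = P∏ m λ r → Pg (s ℕ.+ r)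

    chain-split : ∀ s m n → chain s (m ℕ.+ n) ≈ chain s m * chain (s ℕ.+ m) n
    chain-split s m n = trans (∏-split m n _)
      (*-congˡ (∏-cong n λ r → reflexive (≡.cong g (≡.sym (ℕ.+-assoc s m r)))))

    chain-cancel : ∀ s m {e} → suc (s ℕ.+ m) ≡ e → chain s (suc m) * (1# - Q ^ e) ≈ chain s m
    chain-cancel s m ≡.refl = trans (*-assoc _ _ _) (trans (*-congˡ (inverse (s ℕ.+ m))) (*-identityʳ _))

    P-cancel : ∀ {m N} → m ℕ.< N → P (chain 0 N * (1# - Q ^ suc m))
    P-cancel {m} {N} m<N = resp (begin
      chain 0 m * chain (suc m) (N ℕ.∸ suc m)                                ≈⟨ *-congʳ (chain-cancel 0 m ≡.refl) ⟨
      chain 0 (suc m) * (1# - Q ^ suc m) * chain (suc m) (N ℕ.∸ suc m)       ≈⟨ solve 3 (λ a b c → a :* b :* c := a :* c :* b) refl _ _ _ ⟩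
      chain 0 (suc m) * chain (suc m) (N ℕ.∸ suc m) * (1# - Q ^ suc m)       ≈⟨ *-congʳ (chain-split 0 (suc m) (N ℕ.∸ suc m)) ⟨
      chain 0 (suc m ℕ.+ (N ℕ.∸ suc m)) * (1# - Q ^ suc m)                   ≡⟨ ≡.cong (λ k → chain 0 k * (1# - Q ^ suc m)) (ℕ.m+[n∸m]≡n m<N) ⟩
      chain 0 N * (1# - Q ^ suc m)                                           ∎)
      (P* (P-chain 0 m) (P-chain (suc m) (N ℕ.∸ suc m)))

    block : ℕ → ℕ → Carrier
    block p i = chain (p ℕ.* i) p

    -- The exponents of block i are pi + 1, ..., p(i + 1). The factor 1 - (Q^p)^(i+1) of the Euler
    -- function in Q^p cancels the last of them, and this happens in each of the three copies.
    centre-cone : ∀ h n L → Q ^ L ≈ 0# → suc (L ℕ.+ L) ℕ.≤ n → let p = suc (2 ℕ.* h) in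
      P (cube# (chain 0 (p ℕ.* n)) * (p · 1# * ∑ n (jacobi-term (Q ^ p))))
    centre-cone h n L nil big = resp (begin
      p · 1# * cube# (∏ n (λ i → block p i * (1# - (Q ^ p) ^ suc i)))  ≈⟨ *-congˡ (*-cong HE (*-cong HE HE)) ⟩
      p · 1# * cube# (H * E)
        ≈⟨ solve 3 (λ π h e → π :* ((h :* e) :* ((h :* e) :* (h :* e))) := (h :* (h :* h)) :* (π :* (e :* (e :* e)))) refl (p · 1#) H E ⟩
      cube# H * (p · 1# * cube# E)
        ≈⟨ *-congˡ (*-congˡ (jacobi (Q ^ p) L (trans (^-assocʳ Q p L) (^-zero-≥ nil (ℕ.m≤m+n L _))) n big)) ⟩
      cube# H * (p · 1# * ∑ n (jacobi-term (Q ^ p)))                   ∎)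
      (P* (P-· p P1) (P* P∏′ (P* P∏′ P∏′)))
      where
      p : ℕ
      p = suc (2 ℕ.* h)
      H E : Carrier
      H = chain 0 (p ℕ.* n)
      E = euler-function (Q ^ p) n
      HE : ∏ n (λ i → block p i * (1# - (Q ^ p) ^ suc i)) ≈ H * E
      HE = trans (∏-* n _ _) (*-congʳ (sym (∏-blocks p n g)))
      exponent : ∀ h i → suc (suc (2 ℕ.* h) ℕ.* i ℕ.+ 2 ℕ.* h) ≡ suc (2 ℕ.* h) ℕ.* suc i
      exponent = ℕ.solve-∀
      P∏′ : P (∏ n (λ i → block p i * (1# - (Q ^ p) ^ suc i)))
      P∏′ = P∏ n λ i → resp (sym (trans (*-congˡ (+-congˡ (-‿cong (^-assocʳ Q p (suc i))))) (chain-cancel (p ℕ.* i) (2 ℕ.* h) (exponent h i))))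
                             (P-chain (p ℕ.* i) (2 ℕ.* h))

    module Pair (u′ a n L : ℕ) (nilQ : Q ^ L ≈ 0#) (big : suc (L ℕ.+ L) ℕ.≤ n) where
      -- `u` is a successor because the runs of length `u` in `Block` each give up a last factor.
      u b v p : ℕ
      u = suc u′
      b = suc (2 ℕ.* a)
      v = u ℕ.+ b
      p = suc (2 ℕ.* (u ℕ.+ a))
      X Y t H : Carrier
      X = Q ^ v
      Y = Q ^ u
      t = X * Y
      H = chain 0 (p ℕ.* n)

      v+u≡p : v ℕ.+ u ≡ p
      v+u≡p = identity u a
        where
        identity : ∀ u a → u ℕ.+ suc (2 ℕ.* a) ℕ.+ u ≡ suc (2 ℕ.* (u ℕ.+ a))
        identity = ℕ.solve-∀

      t^ : ∀ i → t ^ i ≈ Q ^ (p ℕ.* i)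
      t^ i = trans (^-congˡ i (trans (sym (^-homo-* Q v u)) (reflexive (≡.cong (Q ^_) v+u≡p)))) (^-assocʳ Q p i)

      nil : t ^ L ≈ 0#
      nil = trans (t^ L) (^-zero-≥ nilQ (ℕ.m≤m+n L _))

      f f′ : ℕ → Carrier
      f  = tripleFactor X Y L nil
      f′ = tripleFactor′ X Y L nil

      module Block (i : ℕ) where
        s : ℕ
        s = p ℕ.* i
        -- The block splits into runs of lengths u, b, u, ending at the exponents pi + u, pi + v and
        -- p(i + 1). These are exactly the exponents in 1 - Y tⁱ, 1 - X tⁱ and 1 - t^(i+1), so each
        -- factor of `f i` shortens one run c to d by its last element.
        c₁ c₂ c₃ d₁ d₂ d₃ : Carrier
        c₁ = chain s u
        c₂ = chain (s ℕ.+ u) b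
        c₃ = chain (s ℕ.+ v) u
        d₁ = chain s u′
        d₂ = chain (s ℕ.+ u) (2 ℕ.* a)
        d₃ = chain (s ℕ.+ v) u′

        block≈ : block p i ≈ (c₁ * c₂) * c₃
        block≈ = trans (reflexive (≡.cong (chain s) (≡.sym v+u≡p)))
          (trans (chain-split s v u) (*-congʳ (chain-split s u b)))

        cancel₁ : c₁ * (1# - Y * t ^ i) ≈ d₁
        cancel₁ = trans (*-congˡ (+-congˡ (-‿cong (trans (*-congˡ (t^ i)) (sym (^-homo-* Q u s))))))
          (chain-cancel s u′ (≡.cong suc (ℕ.+-comm s u′)))

        cancel₂ : c₂ * (1# - X * t ^ i) ≈ d₂
        cancel₂ = trans (*-congˡ (+-congˡ (-‿cong (trans (*-congˡ (t^ i)) (sym (^-homo-* Q v s))))))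
          (chain-cancel (s ℕ.+ u) (2 ℕ.* a) (exponent s u (2 ℕ.* a)))
          where
          exponent : ∀ s u m → suc (s ℕ.+ u ℕ.+ m) ≡ u ℕ.+ suc m ℕ.+ s
          exponent = ℕ.solve-∀

        cancel₃ : c₃ * (1# - t ^ suc i) ≈ d₃
        cancel₃ = trans (*-congˡ (+-congˡ (-‿cong (t^ (suc i)))))
          (chain-cancel (s ℕ.+ v) u′ (≡.trans (exponent s v u′) (≡.trans (≡.cong (ℕ._+ s) v+u≡p) (≡.sym (ℕ.*-suc p i)))))
          where
          exponent : ∀ s v u′ → suc (s ℕ.+ v ℕ.+ u′) ≡ v ℕ.+ suc u′ ℕ.+ s
          exponent = ℕ.solve-∀

        P-factor : P (block p i * f i)
        P-factor = resp (sym (begin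
          block p i * f i
            ≈⟨ *-congʳ block≈ ⟩
          ((c₁ * c₂) * c₃) * ((1# - t ^ suc i) * ((1# - X * t ^ i) * (1# - Y * t ^ i)))
            ≈⟨ solve 6 (λ a b c x y z → ((a :* b) :* c) :* (z :* (y :* x)) := (a :* x) :* ((b :* y) :* (c :* z))) refl c₁ c₂ c₃ _ _ _ ⟩
          (c₁ * (1# - Y * t ^ i)) * ((c₂ * (1# - X * t ^ i)) * (c₃ * (1# - t ^ suc i)))
            ≈⟨ *-cong cancel₁ (*-cong cancel₂ cancel₃) ⟩
          d₁ * (d₂ * d₃) ∎))
          (P* (P-chain _ u′) (P* (P-chain _ (2 ℕ.* a)) (P-chain _ u′)))

        -- What remains of `block p i * f′ i` when 1 - Q^b is set aside: Y - X = Y (1 - Q^b), and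
        -- only the third run is shortened.
        w : Carrier
        w = (c₁ * c₂) * d₃ * (t ^ i * Y)

        Pw : P w
        Pw = P* (P* (P* (P-chain _ u) (P-chain _ b)) (P-chain _ u′)) (P* (P^ i (P* (P^ v PQ) (P^ u PQ))) (P^ u PQ))

        factor′≈ : block p i * f′ i ≈ w * (1# - Q ^ b)
        factor′≈ = begin
          block p i * f′ i
            ≈⟨ *-cong block≈ (*-congˡ (*-congˡ (+-congˡ (-‿cong (^-homo-* Q u b))))) ⟩
          ((c₁ * c₂) * c₃) * ((1# - t ^ suc i) * (t ^ i * (Y - Y * Q ^ b)))
            ≈⟨ solve 6 (λ k c z p y r → (k :* c) :* (z :* (p :* (y :- y :* r))) := k :* (c :* z) :* (p :* y) :* (:1 :- r)) refl
                 (c₁ * c₂) c₃ (1# - t ^ suc i) (t ^ i) Y (Q ^ b) ⟩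
          (c₁ * c₂) * (c₃ * (1# - t ^ suc i)) * (t ^ i * Y) * (1# - Q ^ b)
            ≈⟨ *-congʳ (*-congʳ (*-congˡ cancel₃)) ⟩
          w * (1# - Q ^ b) ∎

      P-product : ∀ m → P (∏ m (block p) * ∏ m f)
      P-product m = resp (∏-* m _ _) (P∏ m Block.P-factor)

      P-derivative : ∀ m → ∃[ W ] (P W × ∏ m (block p) * derivative m f f′ ≈ W * (1# - Q ^ b))
      P-derivative zero = 0# , P0 , trans (zeroʳ _) (sym (zeroˡ _))
      P-derivative (suc m) with W , PW , eq ← P-derivative m =
        (K * F * Block.w m + W * (k * f m)) ,
        P+ (P* (P-product m) (Block.Pw m)) (P* PW (Block.P-factor m)) , (begin
          K * k * (F * f′ m + D * f m)
            ≈⟨ solve 6 (λ K k F x D y → K :* k :* (F :* x :+ D :* y) := (K :* F) :* (k :* x) :+ (K :* D) :* (k :* y)) refl K k F (f′ m) D (f m) ⟩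
          (K * F) * (k * f′ m) + (K * D) * (k * f m)
            ≈⟨ +-cong (*-congˡ (Block.factor′≈ m)) (*-congʳ eq) ⟩
          (K * F) * (Block.w m * r) + W * r * (k * f m)
            ≈⟨ solve 5 (λ c w r W d → c :* (w :* r) :+ W :* r :* d := (c :* w :+ W :* d) :* r) refl (K * F) (Block.w m) r W (k * f m) ⟩
          (K * F * Block.w m + W * (k * f m)) * r ∎)
        where
        K k F D r : Carrier
        K = ∏ m (block p)
        k = block p m
        F = ∏ m f
        D = derivative m f f′
        r = 1# - Q ^ b

      -- Of the three copies of `H`, one is spent block by block on the product or its derivative,
      -- the second absorbs 1 - Q^b in the derivative part, and the third stays as it is.
      class-cone : P (cube# H *
        (b · 1# * ∑ n (λ j → term t X j + term t Y (suc j)) + (2 ℕ.* p) · 1# * ∑ n (λ j → j · 1# * term t X j - suc j · 1# * term t Y (suc j))))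
      class-cone with W , PW , eq ← P-derivative n = resp (begin
        H * (b · 1# * (K * F)) * H + (2 ℕ.* p) · 1# * W * (H * r) * H
          ≈⟨ +-congʳ (*-congʳ (*-congˡ (*-congˡ (*-congʳ K≈H)))) ⟩
        H * (b · 1# * (H * F)) * H + (2 ℕ.* p) · 1# * W * (H * r) * H
          ≈⟨ solve 6 (λ H β F π W r → H :* (β :* (H :* F)) :* H :+ π :* W :* (H :* r) :* H := H :* (H :* (β :* (H :* F) :+ π :* (W :* r)))) refl
               H (b · 1#) F ((2 ℕ.* p) · 1#) W r ⟩
        H * (H * (b · 1# * (H * F) + (2 ℕ.* p) · 1# * (W * r)))
          ≈⟨ *-congˡ (*-congˡ (+-congˡ (*-congˡ (trans (sym eq) (*-congʳ K≈H))))) ⟩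
        H * (H * (b · 1# * (H * F) + (2 ℕ.* p) · 1# * (H * D)))
          ≈⟨ solve 5 (λ H β F π D → H :* (H :* (β :* (H :* F) :+ π :* (H :* D))) := (H :* (H :* H)) :* (β :* F :+ π :* D)) refl
               H (b · 1#) F ((2 ℕ.* p) · 1#) D ⟩
        cube# H * (b · 1# * F + (2 ℕ.* p) · 1# * D)
          ≈⟨ *-congˡ (+-cong (*-congˡ (triple-product X Y L nil n big)) (*-congˡ (triple-product-derivative X Y L nil n big))) ⟩
        _ ∎)
        (P+ (P* (P* PH (P* (P-· b P1) (P-product n))) PH)
            -- `g` is indexed from zero, so the exponent b = 2a + 1 sits at position 2a; it occurs
            -- in `H` because b ≤ p and n ≥ 1.
            (P* (P* (P* (P-· (2 ℕ.* p) P1) PW) (P-cancel {2 ℕ.* a} 2a<pn)) PH))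
        where
        K F D r : Carrier
        K = ∏ n (block p)
        F = ∏ n f
        D = derivative n f f′
        r = 1# - Q ^ b
        K≈H : K ≈ H
        K≈H = sym (∏-blocks p n g)
        PH : P H
        PH = P-chain 0 (p ℕ.* n)
        2a<pn : 2 ℕ.* a ℕ.< p ℕ.* n
        2a<pn = ℕ.≤-trans (s≤s (ℕ.*-monoʳ-≤ 2 (ℕ.m≤n+m a u)))
          (ℕ.≤-trans (ℕ.≤-reflexive (≡.sym (ℕ.*-identityʳ p))) (ℕ.*-monoʳ-≤ p (ℕ.≤-trans (s≤s z≤n) big)))

  module _ (q : Carrier) (g : ℕ → Carrier) (L : ℕ) (nil : q ^ L ≈ 0#) where
    open Dissection R q using (module Class; module Pair)

    module _ (Pg : ∀ m → P (g m)) where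

      class-summand : ∀ h n {a} → a ℕ.< h → (let p = suc (2 ℕ.* h)) →
        P (q ^ p) → (∀ m → g m * (1# - (q ^ p) ^ suc m) ≈ 1#) → suc (L ℕ.+ L) ℕ.≤ n →
        ∃[ S ] (P S × cube# (∏ (p ℕ.* n) g) *
          ∑ n (λ j → jacobi-term q (p ℕ.* j ℕ.+ a) + jacobi-term q (p ℕ.* j ℕ.+ (2 ℕ.* h ℕ.∸ a)))
          ≈ (- 1#) ^ a * q ^ triangle a * S)
      class-summand h n {a} a<h PQ inverse big = main h (h ℕ.∸ suc a) (≡.sym (ℕ.m∸n+n≡m {h} {suc a} a<h)) PQ inverse
        where
        -- `h` is generalised so that h = suc u′ + a can be eliminated by matching on `refl`; the
        -- difference h - a is a successor because a < h.
        main : ∀ h u′ → h ≡ u′ ℕ.+ suc a → (let p = suc (2 ℕ.* h)) →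
          P (q ^ p) → (∀ m → g m * (1# - (q ^ p) ^ suc m) ≈ 1#) →
          ∃[ S ] (P S × cube# (∏ (p ℕ.* n) g) *
            ∑ n (λ j → jacobi-term q (p ℕ.* j ℕ.+ a) + jacobi-term q (p ℕ.* j ℕ.+ (2 ℕ.* h ℕ.∸ a)))
            ≈ (- 1#) ^ a * q ^ triangle a * S)
        main h u′ h≡ PQ inverse with ≡.refl ← ≡.trans h≡ (ℕ.+-suc u′ a) = _ , D.class-cone , (begin
          H³ * ∑ n (λ j → jacobi-term q (p ℕ.* j ℕ.+ a) + jacobi-term q (p ℕ.* j ℕ.+ (2 ℕ.* h ℕ.∸ a)))
            ≡⟨ ≡.cong (λ k → H³ * ∑ n (λ j → jacobi-term q (p ℕ.* j ℕ.+ a) + jacobi-term q (p ℕ.* j ℕ.+ k))) mirror ⟩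
          H³ * ∑ n (λ j → jacobi-term q (p ℕ.* j ℕ.+ a) + jacobi-term q (p ℕ.* j ℕ.+ (2 ℕ.* suc u′ ℕ.+ a)))
            ≈⟨ *-congˡ (Pair.class-sum (suc u′) a n) ⟩
          H³ * ((- 1#) ^ a * q ^ triangle a * _)
            ≈⟨ solve 3 (λ h s x → h :* (s :* x) := s :* (h :* x)) refl H³ _ _ ⟩
          (- 1#) ^ a * q ^ triangle a * (H³ * _) ∎)
          where
          p : ℕ
          p = suc (2 ℕ.* h)
          module D = Quotient.Pair (q ^ p) PQ g Pg inverse u′ a n L (trans (^-assocʳ q p L) (^-zero-≥ nil (ℕ.m≤m+n L _))) big
          H³ : Carrier
          H³ = cube# (∏ (p ℕ.* n) g)
          expand : ∀ u a → 2 ℕ.* (u ℕ.+ a) ≡ 2 ℕ.* u ℕ.+ a ℕ.+ a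
          expand = ℕ.solve-∀
          mirror : 2 ℕ.* (suc u′ ℕ.+ a) ℕ.∸ a ≡ 2 ℕ.* suc u′ ℕ.+ a
          mirror = ≡.trans (≡.cong (ℕ._∸ a) (expand (suc u′) a)) (ℕ.m+n∸n≡m _ a)

      centre-summand : ∀ h n → (let p = suc (2 ℕ.* h)) →
        P (q ^ p) → (∀ m → g m * (1# - (q ^ p) ^ suc m) ≈ 1#) → suc (L ℕ.+ L) ℕ.≤ n →
        ∃[ S ] (P S × cube# (∏ (p ℕ.* n) g) * ∑ n (λ j → jacobi-term q (p ℕ.* j ℕ.+ h))
          ≈ (- 1#) ^ h * q ^ triangle h * S)
      centre-summand h n PQ inverse big = _ ,
        Quotient.centre-cone (q ^ p) PQ g Pg inverse h n L (trans (^-assocʳ q p L) (^-zero-≥ nil (ℕ.m≤m+n L _))) big , (begin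
          H³ * ∑ n (λ j → jacobi-term q (p ℕ.* j ℕ.+ h))
            ≈⟨ *-congˡ (∑-cong n (Class.jacobi-centre h)) ⟩
          H³ * ∑ n (λ j → s * (p · 1# * jacobi-term ((q ^ p) ^ p) j))
            ≈⟨ *-congˡ (trans (sym (*-∑ s n _)) (*-congˡ (sym (*-∑ (p · 1#) n _)))) ⟩
          H³ * (s * (p · 1# * ∑ n (jacobi-term ((q ^ p) ^ p))))
            ≈⟨ solve 3 (λ h s x → h :* (s :* x) := s :* (h :* x)) refl H³ s _ ⟩
          s * (H³ * (p · 1# * ∑ n (jacobi-term ((q ^ p) ^ p)))) ∎)
        where
        p : ℕ
        p = suc (2 ℕ.* h)
        H³ s : Carrier
        H³ = cube# (∏ (p ℕ.* n) g)
        s = (- 1#) ^ h * q ^ triangle h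

    dissection-sum : ∀ h n → (let p = suc (2 ℕ.* h)) → suc (L ℕ.+ L) ℕ.≤ n →
      cube# (euler-function q (p ℕ.* n)) * cube# (∏ (p ℕ.* n) g) ≈
        ∑ h (λ a → cube# (∏ (p ℕ.* n) g) *
          ∑ n (λ j → jacobi-term q (p ℕ.* j ℕ.+ a) + jacobi-term q (p ℕ.* j ℕ.+ (2 ℕ.* h ℕ.∸ a))))
        + cube# (∏ (p ℕ.* n) g) * ∑ n (λ j → jacobi-term q (p ℕ.* j ℕ.+ h))
    dissection-sum h n big = begin
      cube# (euler-function q (p ℕ.* n)) * H³
        ≈⟨ *-congʳ (jacobi q L nil (p ℕ.* n) (ℕ.≤-trans big (ℕ.m≤m+n n _))) ⟩
      ∑ (p ℕ.* n) J * H³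
        ≈⟨ trans (*-comm _ _) (*-congˡ (trans (∑-blocks p n J) (trans (∑-cong n λ j → ∑-mirror h _) (∑-+ n _ _)))) ⟩
      H³ * (∑ n (λ j → ∑ h (λ a → J (p ℕ.* j ℕ.+ a) + J (p ℕ.* j ℕ.+ (2 ℕ.* h ℕ.∸ a)))) + ∑ n (λ j → J (p ℕ.* j ℕ.+ h)))
        ≈⟨ distribˡ H³ _ _ ⟩
      H³ * ∑ n (λ j → ∑ h (λ a → J (p ℕ.* j ℕ.+ a) + J (p ℕ.* j ℕ.+ (2 ℕ.* h ℕ.∸ a)))) + H³ * ∑ n (λ j → J (p ℕ.* j ℕ.+ h))
        ≈⟨ +-congʳ (trans (*-congˡ (∑-swap n h _)) (*-∑ H³ h _)) ⟩
      _ ∎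
      where
      p : ℕ
      p = suc (2 ℕ.* h)
      J : ℕ → Carrier
      J = jacobi-term q
      H³ : Carrier
      H³ = cube# (∏ (p ℕ.* n) g)

    Summand : ℕ → Carrier → Set _
    Summand a x = ∃[ S ] (P S × x ≈ (- 1#) ^ a * q ^ triangle a * S)

    dissection : (∀ m → P (g m)) → ∀ h n → (let p = suc (2 ℕ.* h)) →
      P (q ^ p) → (∀ m → g m * (1# - (q ^ p) ^ suc m) ≈ 1#) → suc (L ℕ.+ L) ℕ.≤ n →
      ∃[ s ] ∃[ centre ] ((∀ {a} → a ℕ.< h → Summand a (s a)) × Summand h centre ×
        cube# (euler-function q (p ℕ.* n)) * cube# (∏ (p ℕ.* n) g) ≈ ∑ h s + centre)
    dissection Pg h n PQ inverse big =
      _ , _ , (λ a<h → class-summand Pg h n a<h PQ inverse big) , centre-summand Pg h n PQ inverse big , dissection-sum h n big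

  -- The factors 1 - q^(2i+1) that survive for p = 2 are 1 + (-q)^(2i+1).
  alternating-cone : ∀ q g → P (- q) → (∀ m → P (g m)) → (∀ m → g m * (1# - q ^ (2 ℕ.* suc m)) ≈ 1#) →
    ∀ n → P (cube# (euler-function q (2 ℕ.* n)) * cube# (∏ (2 ℕ.* n) g))
  alternating-cone q g P-q Pg inverse n = resp (cube#-* _ _) (P* P∏′ (P* P∏′ P∏′))
    where
    e : ℕ → Carrier
    e i = 1# - q ^ suc i
    even : ∀ i → suc (2 ℕ.* i ℕ.+ 1) ≡ 2 ℕ.* suc i
    even = ℕ.solve-∀
    cancel : ∀ i → ∏ 2 (λ r → e (2 ℕ.* i ℕ.+ r)) * g i ≈ e (2 ℕ.* i ℕ.+ 0)
    cancel i = begin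
      1# * e (2 ℕ.* i ℕ.+ 0) * (1# - q ^ suc (2 ℕ.* i ℕ.+ 1)) * g i
        ≡⟨ ≡.cong (λ k → 1# * e (2 ℕ.* i ℕ.+ 0) * (1# - q ^ k) * g i) (even i) ⟩
      1# * e (2 ℕ.* i ℕ.+ 0) * (1# - q ^ (2 ℕ.* suc i)) * g i
        ≈⟨ solve 3 (λ a b c → :1 :* a :* b :* c := a :* (c :* b)) refl _ _ _ ⟩
      e (2 ℕ.* i ℕ.+ 0) * (g i * (1# - q ^ (2 ℕ.* suc i)))
        ≈⟨ trans (*-congˡ (inverse i)) (*-identityʳ _) ⟩
      e (2 ℕ.* i ℕ.+ 0) ∎
    negate : ∀ i → - ((- q) ^ suc (2 ℕ.* i)) ≈ q ^ suc (2 ℕ.* i)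
    negate i = begin
      - (- q * (- q) ^ (2 ℕ.* i))     ≈⟨ -‿cong (*-congˡ (^-assocʳ (- q) 2 i)) ⟨
      - (- q * ((- q) ^ 2) ^ i)       ≈⟨ -‿cong (*-congˡ (^-congˡ i (solve 1 (λ q → (:- q) :* ((:- q) :* :1) := q :* (q :* :1)) refl q))) ⟩
      - (- q * (q ^ 2) ^ i)           ≈⟨ solve 2 (λ q r → :- ((:- q) :* r) := q :* r) refl q _ ⟩
      q * (q ^ 2) ^ i                 ≈⟨ *-congˡ (^-assocʳ q 2 i) ⟩
      q ^ suc (2 ℕ.* i)               ∎
    P-odd : ∀ i → P (e (2 ℕ.* i ℕ.+ 0))
    P-odd i = resp (begin
      1# + (- q) ^ suc (2 ℕ.* i)        ≈⟨ +-congˡ (-‿involutive _) ⟨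
      1# - - (- q) ^ suc (2 ℕ.* i)      ≈⟨ +-congˡ (-‿cong (negate i)) ⟩
      1# - q ^ suc (2 ℕ.* i)            ≡⟨ ≡.cong e (ℕ.+-identityʳ (2 ℕ.* i)) ⟨
      e (2 ℕ.* i ℕ.+ 0)                 ∎)
      (P+ P1 (P^ (suc (2 ℕ.* i)) P-q))
    P∏′ : P (euler-function q (2 ℕ.* n) * ∏ (2 ℕ.* n) g)
    -- The even exponents up to 2n use up only the first n of the 2n inverses; the others remain as
    -- factors from the cone.
    P∏′ = resp (begin
      ∏ n (λ i → ∏ 2 (λ r → e (2 ℕ.* i ℕ.+ r)) * g i) * ∏ (n ℕ.+ 0) (λ i → g (n ℕ.+ i))
        ≈⟨ trans (*-congʳ (∏-* n _ g)) (*-assoc _ _ _) ⟩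
      ∏ n (λ i → ∏ 2 (λ r → e (2 ℕ.* i ℕ.+ r))) * (∏ n g * ∏ (n ℕ.+ 0) (λ i → g (n ℕ.+ i)))
        ≈⟨ *-cong (∏-blocks 2 n e) (∏-split n (n ℕ.+ 0) g) ⟨
      euler-function q (2 ℕ.* n) * ∏ (2 ℕ.* n) g ∎)
      (P* (P∏ n λ i → resp (sym (cancel i)) (P-odd i)) (P∏ (n ℕ.+ 0) λ i → Pg (n ℕ.+ i)))

-- Power series modulo q^(K+1)

open import Data.Integer using (ℤ; +_; _+_; _*_; -_; _≤_; +≤+)
import Data.Integer as ℤ
import Data.Integer.Properties as ℤ
open import Data.Integer.Tactic.RingSolver using (solve-∀)
open ≡ using (refl; sym; trans; cong; cong₂; subst; subst₂)

module Convolution where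
  open ≡.≡-Reasoning

  sumTo-cong : ∀ n {f g} → (∀ {k} → k ℕ.≤ n → f k ≡ g k) → sumTo n f ≡ sumTo n g
  sumTo-cong zero    e = e z≤n
  sumTo-cong (suc n) e = cong₂ _+_ (sumTo-cong n λ k≤n → e (ℕ.m≤n⇒m≤1+n k≤n)) (e ℕ.≤-refl)

  sumTo-suc : ∀ n f → sumTo (suc n) f ≡ f 0 + sumTo n (λ k → f (suc k))
  sumTo-suc zero    f = refl
  sumTo-suc (suc n) f = trans (cong (_+ f (suc (suc n))) (sumTo-suc n f)) (ℤ.+-assoc (f 0) _ _)

  sumTo-+ : ∀ n f g → sumTo n (λ k → f k + g k) ≡ sumTo n f + sumTo n g
  sumTo-+ zero    f g = refl
  sumTo-+ (suc n) f g = trans (cong (_+ (f (suc n) + g (suc n))) (sumTo-+ n f g)) (identity (sumTo n f) _ (f (suc n)) _)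
    where
    identity : ∀ a b c d → a + b + (c + d) ≡ a + c + (b + d)
    identity = solve-∀

  sumTo-* : ∀ n c f → sumTo n (λ k → c * f k) ≡ c * sumTo n f
  sumTo-* zero    c f = refl
  sumTo-* (suc n) c f = trans (cong (_+ c * f (suc n)) (sumTo-* n c f)) (sym (ℤ.*-distribˡ-+ c (sumTo n f) (f (suc n))))

  sumTo-0 : ∀ n → sumTo n (λ _ → + 0) ≡ + 0
  sumTo-0 zero    = refl
  sumTo-0 (suc n) = trans (ℤ.+-identityʳ _) (sumTo-0 n)

  tail : Series → Series
  tail f k = f (suc k)

  ⊛-cong : ∀ n {f f′ g g′} → (∀ {k} → k ℕ.≤ n → f k ≡ f′ k) → (∀ {k} → k ℕ.≤ n → g k ≡ g′ k) → (f ⊛ g) n ≡ (f′ ⊛ g′) n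
  ⊛-cong n e e′ = sumTo-cong n λ {k} k≤n → cong₂ _*_ (e k≤n) (e′ (ℕ.m∸n≤m n k))

  ⊛-suc : ∀ f g n → (f ⊛ g) (suc n) ≡ f 0 * g (suc n) + (tail f ⊛ g) n
  ⊛-suc f g n = sumTo-suc n (λ k → f k * g (suc n ℕ.∸ k))

  ⊛-sucʳ : ∀ f g n → (f ⊛ g) (suc n) ≡ (f ⊛ tail g) n + f (suc n) * g 0
  ⊛-sucʳ f g n = cong₂ _+_
    (sumTo-cong n λ {k} k≤n → cong (λ j → f k * g j) (ℕ.+-∸-assoc 1 k≤n))
    (cong (λ j → f (suc n) * g j) (ℕ.n∸n≡0 n))

  ⊛-comm : ∀ f g n → (f ⊛ g) n ≡ (g ⊛ f) n
  ⊛-comm f g zero    = ℤ.*-comm (f 0) (g 0)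
  ⊛-comm f g (suc n) = begin
    (f ⊛ g) (suc n)                     ≡⟨ ⊛-suc f g n ⟩
    f 0 * g (suc n) + (tail f ⊛ g) n    ≡⟨ cong₂ _+_ (ℤ.*-comm (f 0) _) (⊛-comm (tail f) g n) ⟩
    g (suc n) * f 0 + (g ⊛ tail f) n    ≡⟨ ℤ.+-comm (g (suc n) * f 0) _ ⟩
    (g ⊛ tail f) n + g (suc n) * f 0    ≡⟨ ⊛-sucʳ g f n ⟨
    (g ⊛ f) (suc n)                     ∎

  ⊛-distribˡ : ∀ f g h n → (f ⊛ (λ k → g k + h k)) n ≡ (f ⊛ g) n + (f ⊛ h) n
  ⊛-distribˡ f g h n = trans (sumTo-cong n λ {k} _ → ℤ.*-distribˡ-+ (f k) (g (n ℕ.∸ k)) (h (n ℕ.∸ k))) (sumTo-+ n _ _)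

  ⊛-distribʳ : ∀ f g h n → ((λ k → g k + h k) ⊛ f) n ≡ (g ⊛ f) n + (h ⊛ f) n
  ⊛-distribʳ f g h n = trans (⊛-comm (λ k → g k + h k) f n) (trans (⊛-distribˡ f g h n) (cong₂ _+_ (⊛-comm f g n) (⊛-comm f h n)))

  ⊛-scaleˡ : ∀ c f g n → ((λ k → c * f k) ⊛ g) n ≡ c * (f ⊛ g) n
  ⊛-scaleˡ c f g n = trans (sumTo-cong n λ {k} _ → ℤ.*-assoc c (f k) (g (n ℕ.∸ k))) (sumTo-* n c _)

  -- Induction on the coefficient with f = f 0 + q · `tail f`, which replaces the reindexing of a
  -- double sum: the tail of f ⊛ g is f 0 · `tail g` + `tail f` ⊛ g.
  ⊛-assoc : ∀ f g h n → ((f ⊛ g) ⊛ h) n ≡ (f ⊛ (g ⊛ h)) n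
  ⊛-assoc f g h zero    = ℤ.*-assoc (f 0) (g 0) (h 0)
  ⊛-assoc f g h (suc n) = begin
    ((f ⊛ g) ⊛ h) (suc n)
      ≡⟨ ⊛-suc (f ⊛ g) h n ⟩
    f 0 * g 0 * h (suc n) + (tail (f ⊛ g) ⊛ h) n
      ≡⟨ cong (λ z → f 0 * g 0 * h (suc n) + z) (begin
           (tail (f ⊛ g) ⊛ h) n
             ≡⟨ ⊛-cong n {g′ = h} (λ {k} _ → ⊛-suc f g k) (λ _ → refl) ⟩
           ((λ k → f 0 * tail g k + (tail f ⊛ g) k) ⊛ h) n
             ≡⟨ ⊛-distribʳ h (λ k → f 0 * tail g k) (tail f ⊛ g) n ⟩
           ((λ k → f 0 * tail g k) ⊛ h) n + ((tail f ⊛ g) ⊛ h) n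
             ≡⟨ cong₂ _+_ (⊛-scaleˡ (f 0) (tail g) h n) (⊛-assoc (tail f) g h n) ⟩
           f 0 * (tail g ⊛ h) n + (tail f ⊛ (g ⊛ h)) n ∎) ⟩
    f 0 * g 0 * h (suc n) + (f 0 * (tail g ⊛ h) n + (tail f ⊛ (g ⊛ h)) n)
      ≡⟨ identity (f 0) (g 0) (h (suc n)) _ _ ⟩
    f 0 * (g 0 * h (suc n) + (tail g ⊛ h) n) + (tail f ⊛ (g ⊛ h)) n
      ≡⟨ cong (λ z → f 0 * z + (tail f ⊛ (g ⊛ h)) n) (⊛-suc g h n) ⟨
    f 0 * (g ⊛ h) (suc n) + (tail f ⊛ (g ⊛ h)) n
      ≡⟨ ⊛-suc f (g ⊛ h) n ⟨
    (f ⊛ (g ⊛ h)) (suc n) ∎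
    where
    identity : ∀ a b c d e → a * b * c + (a * d + e) ≡ a * (b * c + d) + e
    identity = solve-∀

  ⊛-zeroˡ : ∀ f n → ((λ _ → + 0) ⊛ f) n ≡ + 0
  ⊛-zeroˡ f n = trans (sumTo-cong n λ {k} _ → ℤ.*-zeroˡ (f (n ℕ.∸ k))) (sumTo-0 n)

  ⊛-identityˡ : ∀ f n → (one ⊛ f) n ≡ f n
  ⊛-identityˡ f zero    = ℤ.*-identityˡ (f 0)
  ⊛-identityˡ f (suc n) = trans (⊛-suc one f n) (trans (cong₂ _+_ (ℤ.*-identityˡ (f (suc n))) (⊛-zeroˡ f n)) (ℤ.+-identityʳ _))

  -- Only the equality is truncated; the elements remain full series, so the definitions of the
  -- statement can be used in the ring unchanged. In it `q` is nilpotent.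
  truncated : ℕ → CommutativeRing 0ℓ 0ℓ
  truncated K = record
    { Carrier = Series
    ; _≈_ = λ f g → ∀ {k} → k ℕ.≤ K → f k ≡ g k
    ; _+_ = λ f g k → f k + g k
    ; _*_ = _⊛_
    ; -_ = λ f k → - f k
    ; 0# = λ _ → + 0
    ; 1# = one
    ; isCommutativeRing = record
      { isRing = record
        { +-isAbelianGroup = record
          { isGroup = record
            { isMonoid = record
              { isSemigroup = record
                { isMagma = record
                  { isEquivalence = record
                    { refl = λ _ → refl
                    ; sym = λ e k≤K → sym (e k≤K)
                    ; trans = λ e e′ k≤K → trans (e k≤K) (e′ k≤K) }
                  ; ∙-cong = λ e e′ k≤K → cong₂ _+_ (e k≤K) (e′ k≤K) }
                ; assoc = λ f g h {k} _ → ℤ.+-assoc (f k) (g k) (h k) }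
              ; identity = (λ f {k} _ → ℤ.+-identityˡ (f k)) , (λ f {k} _ → ℤ.+-identityʳ (f k)) }
            ; inverse = (λ f {k} _ → ℤ.+-inverseˡ (f k)) , (λ f {k} _ → ℤ.+-inverseʳ (f k))
            ; ⁻¹-cong = λ e k≤K → cong -_ (e k≤K) }
          ; comm = λ f g {k} _ → ℤ.+-comm (f k) (g k) }
        ; *-cong = λ {f} {f′} {g} {g′} e e′ {k} k≤K → ⊛-cong k {f} {f′} {g} {g′} (λ j≤k → e (ℕ.≤-trans j≤k k≤K)) (λ j≤k → e′ (ℕ.≤-trans j≤k k≤K))
        ; *-assoc = λ f g h {k} _ → ⊛-assoc f g h k
        ; *-identity = (λ f {k} _ → ⊛-identityˡ f k) , (λ f {k} _ → trans (⊛-comm f one k) (⊛-identityˡ f k))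
        ; distrib = (λ f g h {k} _ → ⊛-distribˡ f g h k) , (λ f g h {k} _ → ⊛-distribʳ f g h k) }
      ; *-comm = λ f g {k} _ → ⊛-comm f g k } }

  q : Series
  q zero    = + 0
  q (suc k) = one k

  q-⊛-suc : ∀ f n → (q ⊛ f) (suc n) ≡ f n
  q-⊛-suc f n = trans (⊛-suc q f n) (trans (cong (_+ (one ⊛ f) n) (ℤ.*-zeroˡ (f (suc n)))) (trans (ℤ.+-identityˡ _) (⊛-identityˡ f n)))

module Truncated (K : ℕ) where
  open Convolution
  module R = Ring (truncated K)
  open R using (_≈_; _^_)
  open ≡.≡-Reasoning

  q^-coefficient : ∀ m k → (q ^ m) k ≡ (if does (k ℕ.≟ m) then + 1 else + 0)
  q^-coefficient zero    zero    = refl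
  q^-coefficient zero    (suc k) = refl
  q^-coefficient (suc m) zero    = refl
  q^-coefficient (suc m) (suc k) = trans (q-⊛-suc (q ^ m) k) (q^-coefficient m k)

  q^-⊛-+ : ∀ m f k → ((q ^ m) ⊛ f) (m ℕ.+ k) ≡ f k
  q^-⊛-+ zero    f k = ⊛-identityˡ f k
  q^-⊛-+ (suc m) f k = trans (⊛-assoc q (q ^ m) f (suc m ℕ.+ k)) (trans (q-⊛-suc ((q ^ m) ⊛ f) (m ℕ.+ k)) (q^-⊛-+ m f k))

  q^-⊛-< : ∀ m f {k} → k ℕ.< m → ((q ^ m) ⊛ f) k ≡ + 0
  q^-⊛-< (suc m) f {zero}  _         = trans (⊛-assoc q (q ^ m) f 0) (ℤ.*-zeroˡ (((q ^ m) ⊛ f) 0))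
  q^-⊛-< (suc m) f {suc k} (s≤s k<m) = trans (⊛-assoc q (q ^ m) f (suc k)) (trans (q-⊛-suc ((q ^ m) ⊛ f) k) (q^-⊛-< m f k<m))

  q^-nilpotent : q ^ suc K ≈ R.0#
  q^-nilpotent {k} k≤K = trans (q^-coefficient (suc K) k)
    (cong (if_then + 1 else + 0) (dec-false (k ℕ.≟ suc K) (ℕ.<⇒≢ (s≤s k≤K))))

  oneMinusQ≈ : ∀ m → oneMinusQ (suc m) ≈ R.1# R.- q ^ suc m
  oneMinusQ≈ m {zero}  _ = refl
  oneMinusQ≈ m {suc k} _ rewrite q^-coefficient (suc m) (suc k) with does (suc k ℕ.≟ suc m)
  ... | true  = refl
  ... | false = refl

  geomQ-+ : ∀ d k → geomQ d (d ℕ.+ k) ≡ geomQ d k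
  geomQ-+ d k = cong (if_then + 1 else + 0)
    (does-⇔ (mk⇔ (λ d∣d+k → ∣m+n∣m⇒∣n d∣d+k ∣-refl) (∣m∣n⇒∣m+n ∣-refl)) (d ∣? d ℕ.+ k) (d ∣? k))

  geomQ-< : ∀ d {k} → k ℕ.< d → geomQ d k ≡ one k
  geomQ-< d {zero}  _   = cong (if_then + 1 else + 0) (dec-true (d ∣? 0) (d ∣0))
  geomQ-< d {suc k} k<d = cong (if_then + 1 else + 0) (dec-false (d ∣? suc k) (>⇒∤ k<d))

  -- The coefficients of `geomQ d` have period d. From exponent d on, the series and its shift by d
  -- cancel; below d the shift contributes nothing, and only the constant term is left.
  geomQ-inverse : ∀ d → 1 ℕ.≤ d → geomQ d R.* (R.1# R.- q ^ d) ≈ R.1#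
  geomQ-inverse d 1≤d = R.trans (R.*-1- (geomQ d) (q ^ d)) λ {k} _ → lemma k
    where
    coefficient : ℕ → ℤ
    coefficient k = geomQ d k + - ((q ^ d) ⊛ geomQ d) k
    one-≥ : ∀ d j → 1 ℕ.≤ d → one (d ℕ.+ j) ≡ + 0
    one-≥ (suc d) j _ = refl
    coefficient-≥ : ∀ j → coefficient (d ℕ.+ j) ≡ one (d ℕ.+ j)
    coefficient-≥ j = trans (cong₂ (λ x y → x + - y) (geomQ-+ d j) (q^-⊛-+ d (geomQ d) j))
                            (trans (ℤ.+-inverseʳ (geomQ d j)) (sym (one-≥ d j 1≤d)))
    lemma : ∀ k → coefficient k ≡ one k
    lemma k with k ℕ.<? d
    ... | yes k<d = trans (cong₂ (λ x y → x + - y) (geomQ-< d k<d) (q^-⊛-< d (geomQ d) k<d)) (ℤ.+-identityʳ _)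
    ... | no  k≮d = subst (λ k → coefficient k ≡ one k) (ℕ.m+[n∸m]≡n (ℕ.≮⇒≥ k≮d)) (coefficient-≥ (k ℕ.∸ d))

-- Signs and residue classes of coefficients.

module Signs where
  open ≡.≡-Reasoning

  0≤* : ∀ {x y} → + 0 ≤ x → + 0 ≤ y → + 0 ≤ x * y
  0≤* {+ m} {+ n} _ _ = subst (+ 0 ≤_) (ℤ.pos-* m n) (+≤+ z≤n)

  0≤*-* : ∀ s s′ {x y} → + 0 ≤ s * x → + 0 ≤ s′ * y → + 0 ≤ s * s′ * (x * y)
  0≤*-* s s′ {x} {y} sx s′y = subst (+ 0 ≤_) (identity s x s′ y) (0≤* sx s′y)
    where
    identity : ∀ s x s′ y → s * x * (s′ * y) ≡ s * s′ * (x * y)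
    identity = solve-∀

  0≤*-+ : ∀ s {x y} → + 0 ≤ s * x → + 0 ≤ s * y → + 0 ≤ s * (x + y)
  0≤*-+ s {x} {y} sx sy = subst (+ 0 ≤_) (sym (ℤ.*-distribˡ-+ s x y)) (ℤ.+-mono-≤ sx sy)

  sign : ℕ → ℤ
  sign a = (- + 1) ℤ.^ a

  sign-square : ∀ a → sign a * sign a ≡ + 1
  sign-square zero    = refl
  sign-square (suc a) = trans (identity (sign a)) (sign-square a)
    where
    identity : ∀ s → (- + 1) * s * ((- + 1) * s) ≡ s * s
    identity = solve-∀

  same-sign : ∀ a {x y} → + 0 ≤ sign a * x → + 0 ≤ sign a * y → + 0 ≤ x * y
  same-sign a {x} {y} sx sy = subst (+ 0 ≤_) (trans (cong (_* (x * y)) (sign-square a)) (ℤ.*-identityˡ (x * y))) (0≤*-* (sign a) (sign a) sx sy)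

module Graded where
  open Convolution
  open Signs

  geomQ-elim : ∀ (C : ℤ → Set) d k → (d ∣ k → C (+ 1)) → C (+ 0) → C (geomQ d k)
  geomQ-elim C d k c1 c0 with d ∣? k
  ... | yes d∣k = c1 d∣k
  ... | no  _   = c0

  sumTo-closed : ∀ {C : ℤ → Set} → (∀ {x y} → C x → C y → C (x + y)) →
                 ∀ n {f} → (∀ {k} → k ℕ.≤ n → C (f k)) → C (sumTo n f)
  sumTo-closed {C} C+ zero    cf = cf z≤n
  sumTo-closed {C} C+ (suc n) cf = C+ (sumTo-closed {C} C+ n λ k≤n → cf (ℕ.m≤n⇒m≤1+n k≤n)) (cf ℕ.≤-refl)

  -- The predicates depend on the exponent, so one argument covers both the alternating cone and the
  -- grading by residues.
  ⊛-closed : ∀ {A B C : ℕ → ℤ → Set} →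
             (∀ {k x y} → C k x → C k y → C k (x + y)) →
             (∀ {i j x y} → A i x → B j y → C (i ℕ.+ j) (x * y)) →
             ∀ {K f g} → (∀ {k} → k ℕ.≤ K → A k (f k)) → (∀ {k} → k ℕ.≤ K → B k (g k)) →
             ∀ {n} → n ℕ.≤ K → C n ((f ⊛ g) n)
  ⊛-closed {C = C} C+ A*B {f = f} {g} af bg {n} n≤K = sumTo-closed {C n} C+ n λ {k} k≤n →
    subst (λ m → C m (f k * g (n ℕ.∸ k))) (ℕ.m+[n∸m]≡n k≤n)
      (A*B (af (ℕ.≤-trans k≤n n≤K)) (bg (ℕ.≤-trans (ℕ.m∸n≤m n k) n≤K)))

  Alternating : ℕ → ℤ → Set
  Alternating k x = + 0 ≤ sign k * x

  alternating : ∀ K → IsCone (truncated K) (λ f → ∀ {k} → k ℕ.≤ K → Alternating k (f k))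
  alternating K = record
    { resp = λ e a {k} k≤K → subst (Alternating k) (e k≤K) (a k≤K)
    ; P0 = λ {k} _ → ℤ.≤-reflexive (sym (ℤ.*-zeroʳ (sign k)))
    ; P1 = λ { {zero} _ → +≤+ z≤n ; {suc k} _ → ℤ.≤-reflexive (sym (ℤ.*-zeroʳ (sign (suc k)))) }
    ; P+ = λ a b {k} k≤K → 0≤*-+ (sign k) (a k≤K) (b k≤K)
    ; P* = λ {f} {g} → ⊛-closed {Alternating} {Alternating} {Alternating} (λ {k} → 0≤*-+ (sign k))
             (λ {i} {j} {x} {y} a b → subst (λ s → + 0 ≤ s * (x * y)) (sym (ℤ.^-distribˡ-+-* (- + 1) i j)) (0≤*-* (sign i) (sign j) a b))
             {f = f} {g}
    }

  module Modulo (p : ℕ) .{{_ : ℕ.NonZero p}} where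

    -- A condition on the coefficient `x` of q^k. Residue and sign are tracked together since both
    -- are multiplicative: under convolution residues add and signs multiply.
    record InClass (r : ℕ) (s : ℤ) (k : ℕ) (x : ℤ) : Set where
      constructor _,_
      field
        support     : x ≡ + 0 ⊎ k % p ≡ r % p
        signed      : + 0 ≤ s * x

    InClass-0 : ∀ {r s k} → InClass r s k (+ 0)
    InClass-0 {s = s} = inj₁ refl , ℤ.≤-reflexive (sym (ℤ.*-zeroʳ s))

    InClass-+ : ∀ {r s k x y} → InClass r s k x → InClass r s k y → InClass r s k (x + y)
    InClass-+ {s = s} (inj₁ refl , a) (inj₁ refl , b) = InClass-0 {s = s}
    InClass-+ {s = s} (inj₂ e    , a) (_         , b) = inj₂ e , 0≤*-+ s a b
    InClass-+ {s = s} (inj₁ _    , a) (inj₂ e    , b) = inj₂ e , 0≤*-+ s a b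

    InClass-* : ∀ {r s r′ s′ i j x y} → InClass r s i x → InClass r′ s′ j y → InClass (r ℕ.+ r′) (s * s′) (i ℕ.+ j) (x * y)
    InClass-* {s = s} {s′ = s′} {y = y} (inj₁ refl , a) (_ , b) = inj₁ (ℤ.*-zeroˡ y) , 0≤*-* s s′ a b
    InClass-* {s = s} {s′ = s′} {x = x} (inj₂ _ , a) (inj₁ refl , b) = inj₁ (ℤ.*-zeroʳ x) , 0≤*-* s s′ a b
    InClass-* {r} {s} {r′} {s′} {i} {j} (inj₂ e , a) (inj₂ e′ , b) =
      inj₂ (trans (%-distribˡ-+ i j p) (trans (cong₂ (λ m n → (m ℕ.+ n) % p) e e′) (sym (%-distribˡ-+ r r′ p)))) , 0≤*-* s s′ a b

    module _ (K : ℕ) where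
      private module R = Ring (truncated K)

      SeriesInClass : ℕ → ℤ → Series → Set
      SeriesInClass r s f = ∀ {k} → k ℕ.≤ K → InClass r s k (f k)

      SeriesInClass-* : ∀ {r s r′ s′ f g} → SeriesInClass r s f → SeriesInClass r′ s′ g → SeriesInClass (r ℕ.+ r′) (s * s′) (f ⊛ g)
      SeriesInClass-* {r} {s} {r′} {s′} {f} {g} =
        ⊛-closed {InClass r s} {InClass r′ s′} {InClass (r ℕ.+ r′) (s * s′)} InClass-+ InClass-* {f = f} {g}

      SeriesInClass-resp : ∀ {r s f g} → f R.≈ g → SeriesInClass r s f → SeriesInClass r s g
      SeriesInClass-resp {r} {s} e a {k} k≤K = subst (InClass r s k) (e k≤K) (a k≤K)

      SeriesInClass-one : SeriesInClass 0 (+ 1) one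
      SeriesInClass-one {zero}  _ = inj₂ refl , +≤+ z≤n
      SeriesInClass-one {suc k} _ = InClass-0 {0} {+ 1} {suc k}

      -- The support condition matters as much as the sign: members are series in q^p, so
      -- multiplication by ± q^m leaves them on the single residue of m.
      nonNegative : IsCone (truncated K) (SeriesInClass 0 (+ 1))
      nonNegative = record
        { resp = SeriesInClass-resp
        ; P0   = λ _ → InClass-0 {0} {+ 1}
        ; P1   = SeriesInClass-one
        ; P+   = λ a b k≤K → InClass-+ (a k≤K) (b k≤K)
        ; P*   = λ {f} {g} → SeriesInClass-* {f = f} {g}
        }

      SeriesInClass-q : SeriesInClass 1 (+ 1) q
      SeriesInClass-q {zero}        _ = InClass-0 {1} {+ 1} {0}
      SeriesInClass-q {suc zero}    _ = inj₂ refl , +≤+ z≤n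
      SeriesInClass-q {suc (suc k)} _ = InClass-0 {1} {+ 1} {suc (suc k)}

      SeriesInClass-q^ : ∀ m → SeriesInClass m (+ 1) (q R.^ m)
      SeriesInClass-q^ zero    = SeriesInClass-one
      SeriesInClass-q^ (suc m) = SeriesInClass-* {f = q} {q R.^ m} SeriesInClass-q (SeriesInClass-q^ m)

      SeriesInClass-minus-one : SeriesInClass 0 (- + 1) (R.- R.1#)
      SeriesInClass-minus-one {zero}  _ = inj₂ refl , +≤+ z≤n
      SeriesInClass-minus-one {suc k} _ = InClass-0 {0} { - + 1} {suc k}

      SeriesInClass-sign : ∀ a → SeriesInClass 0 (sign a) ((R.- R.1#) R.^ a)
      SeriesInClass-sign zero    = SeriesInClass-one
      SeriesInClass-sign (suc a) = SeriesInClass-* {f = R.- R.1#} {(R.- R.1#) R.^ a} SeriesInClass-minus-one (SeriesInClass-sign a)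

      SeriesInClass-shift : ∀ a m {S} → SeriesInClass 0 (+ 1) S →
        SeriesInClass m (sign a) ((R.- R.1#) R.^ a R.* q R.^ m R.* S)
      SeriesInClass-shift a m {S} PS = subst₂ (λ r s → SeriesInClass r s ((R.- R.1#) R.^ a R.* q R.^ m R.* S))
        (ℕ.+-identityʳ m) (trans (ℤ.*-identityʳ (sign a * + 1)) (ℤ.*-identityʳ (sign a)))
        (SeriesInClass-* {f = (R.- R.1#) R.^ a R.* q R.^ m} {S}
          (SeriesInClass-* {f = (R.- R.1#) R.^ a} {q R.^ m} (SeriesInClass-sign a) (SeriesInClass-q^ m)) PS)

      SeriesInClass-mod : ∀ {r r′ s f} → r % p ≡ r′ % p → SeriesInClass r s f → SeriesInClass r′ s f
      SeriesInClass-mod e a k≤K with a k≤K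
      ... | inj₁ z  , pos = inj₁ z , pos
      ... | inj₂ e′ , pos = inj₂ (trans e′ e) , pos

      geomQ-InClass : ∀ {d} → p ∣ d → SeriesInClass 0 (+ 1) (geomQ d)
      geomQ-InClass {d} p∣d {k} _ = geomQ-elim (InClass 0 (+ 1) k) d k
        (λ d∣k → inj₂ (%-remove-+ʳ 0 (∣-trans p∣d d∣k)) , +≤+ z≤n) InClass-0

-- From the defining partial products to products in the truncated ring.

module PartialProducts (p : ℕ) (1≤p : 1 ℕ.≤ p) where
  open Convolution

  geom : ℕ → Series
  geom m = geomQ (p ℕ.* suc m)

  factor≈1 : ∀ N → (let open Ring (truncated N)) → factor p (suc N) ≈ 1#
  factor≈1 N = R.trans (R.*-cong {cube (oneMinusQ (suc N))} {one} {cube (geomQ (p ℕ.* suc N))} {one}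
      (R.trans {cube (oneMinusQ (suc N))} (R.cube#-cong {oneMinusQ (suc N)} {one} minus) R.cube#-1)
      (R.trans {cube (geomQ (p ℕ.* suc N))} (R.cube#-cong {geomQ (p ℕ.* suc N)} {one} geometric) R.cube#-1))
    (R.*-identityˡ one)
    where
    module R = Ring (truncated N)
    minus : oneMinusQ (suc N) R.≈ one
    minus {zero}  _ = refl
    minus {suc k} k<N = cong (if_then - + 1 else + 0) (dec-false (suc k ℕ.≟ suc N) (ℕ.<⇒≢ (s≤s k<N)))
    geometric : geomQ (p ℕ.* suc N) R.≈ one
    geometric k≤N = Truncated.geomQ-< N (p ℕ.* suc N) (ℕ.≤-trans (s≤s k≤N) (ℕ.≤-trans (ℕ.≤-reflexive (sym (ℕ.*-identityˡ _))) (ℕ.*-monoˡ-≤ (suc N) 1≤p)))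

  -- Later factors are 1 up to the exponent in question. Hence the coefficients at n and n + p can
  -- be read off one common partial product, as long as the dissection requires.
  stable : ∀ N d → partialProd p (d ℕ.+ N) N ≡ c3 p N
  stable N zero    = refl
  stable N (suc d) = trans step (stable N d)
    where
    module R = Ring (truncated (d ℕ.+ N))
    F : Series
    F = partialProd p (d ℕ.+ N)
    step : (F ⊛ factor p (suc (d ℕ.+ N))) N ≡ F N
    step = R.trans (R.*-congˡ {F} {factor p (suc (d ℕ.+ N))} {one} (factor≈1 (d ℕ.+ N))) (R.*-identityʳ F) (ℕ.m≤n+m N d)

  c3≡ : ∀ {k N} → k ℕ.≤ N → c3 p k ≡ partialProd p N k
  c3≡ {k} {N} k≤N = sym (trans (cong (λ M → partialProd p M k) (sym (ℕ.m∸n+n≡m k≤N))) (stable k (N ℕ.∸ k)))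

  module _ (K : ℕ) where
    private module R = Ring (truncated K)
    open Jacobi (truncated K) using (euler-function)

    partialProd≈ : ∀ N → partialProd p N R.≈ R.cube# (euler-function q N) R.* R.cube# (R.∏ N geom)
    partialProd≈ N = R.trans (R.reflexive (unfold N)) (R.trans
      (R.∏-cong N λ i → R.*-congʳ {cube (geom i)} (R.cube#-cong {oneMinusQ (suc i)} (Truncated.oneMinusQ≈ K i)))
      (R.trans (R.∏-* N _ (λ i → cube (geom i))) (R.*-cong (R.∏-cube# N _) (R.∏-cube# N geom))))
      where
      unfold : ∀ N → partialProd p N ≡ R.∏ N (λ i → factor p (suc i))
      unfold zero    = refl
      unfold (suc N) = cong (_⊛ factor p (suc N)) (unfold N)

    geom-inverse : ∀ m → geom m R.* (R.1# R.- q R.^ (p ℕ.* suc m)) R.≈ R.1#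
    geom-inverse m = Truncated.geomQ-inverse K (p ℕ.* suc m) (ℕ.*-mono-≤ 1≤p (s≤s z≤n))

-- The prime 2.

module EvenPrime where
  open Convolution
  open Signs
  open Graded
  open PartialProducts 2 (s≤s z≤n)

  even-sign : ∀ l m → sign (l ℕ.* (2 ℕ.* m)) ≡ + 1
  even-sign l m = trans (cong sign (identity l m)) (trans (ℤ.^-distribˡ-+-* (- + 1) (l ℕ.* m) (l ℕ.* m)) (sign-square (l ℕ.* m)))
    where
    identity : ∀ l m → l ℕ.* (2 ℕ.* m) ≡ l ℕ.* m ℕ.+ l ℕ.* m
    identity = ℕ.solve-∀

  c3-alternating : ∀ n → Alternating n (c3 2 n)
  c3-alternating n = subst (Alternating n) (sym (c3≡ (ℕ.m≤m+n n _)))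
    (IsCone.resp (alternating n) (R.sym {partialProd 2 (2 ℕ.* n)} (partialProd≈ n (2 ℕ.* n)))
      (Positivity.alternating-cone (truncated n) (alternating n) q geom negative positive (geom-inverse n) n) ℕ.≤-refl)
    where
    module R = Ring (truncated n)
    negative : ∀ {k} → k ℕ.≤ n → Alternating k (- q k)
    negative {zero}        _ = +≤+ z≤n
    negative {suc zero}    _ = +≤+ z≤n
    negative {suc (suc k)} _ = ℤ.≤-reflexive (sym (ℤ.*-zeroʳ (sign (suc (suc k)))))
    positive : ∀ m {k} → k ℕ.≤ n → Alternating k (geom m k)
    positive m {k} _ = geomQ-elim (Alternating k) (2 ℕ.* suc m) k
      (λ { (divides l refl) → subst (λ s → + 0 ≤ s * + 1) (sym (even-sign l (suc m))) (+≤+ z≤n) })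
      (ℤ.≤-reflexive (sym (ℤ.*-zeroʳ (sign k))))

  c3-same-sign : ∀ n → + 0 ≤ c3 2 n * c3 2 (n ℕ.+ 2)
  c3-same-sign n = same-sign n (c3-alternating n)
    (subst (λ s → + 0 ≤ s * c3 2 (n ℕ.+ 2)) (trans (ℤ.^-distribˡ-+-* (- + 1) n 2) (ℤ.*-identityʳ (sign n))) (c3-alternating (n ℕ.+ 2)))

-- Odd primes: distinct residues and the comparison of n with n + p.

module OddPrime (h : ℕ) (p-prime : Prime (suc (2 ℕ.* h))) where
  open Convolution
  open Signs
  open Graded

  p : ℕ
  p = suc (2 ℕ.* h)

  open Modulo p
  open PartialProducts p (s≤s z≤n)

  %≡⇒∣ : ∀ m d → (m ℕ.+ d) % p ≡ m % p → p ∣ d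
  %≡⇒∣ m d e = ∣m+n∣m⇒∣n {p} {m / p ℕ.* p} (divides ((m ℕ.+ d) / p) (ℕ.+-cancelˡ-≡ (m % p) _ _ (Eq.begin
    m % p ℕ.+ (m / p ℕ.* p ℕ.+ d)                    Eq.≡⟨ ℕ.+-assoc (m % p) _ d ⟨
    m % p ℕ.+ m / p ℕ.* p ℕ.+ d                      Eq.≡⟨ cong (ℕ._+ d) (m≡m%n+[m/n]*n m p) ⟨
    m ℕ.+ d                                          Eq.≡⟨ m≡m%n+[m/n]*n (m ℕ.+ d) p ⟩
    (m ℕ.+ d) % p ℕ.+ (m ℕ.+ d) / p ℕ.* p            Eq.≡⟨ cong (ℕ._+ (m ℕ.+ d) / p ℕ.* p) e ⟩
    m % p ℕ.+ (m ℕ.+ d) / p ℕ.* p                    Eq.∎))) (n∣m*n (m / p))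
    where module Eq = ≡.≡-Reasoning

  -- Twice the difference of the triangular numbers is (a′ - a) (a′ + a + 1). Both factors are
  -- positive and at most 2h < p, so the prime p divides neither of them.
  triangle-distinct : ∀ {a a′} → a ℕ.< a′ → a′ ℕ.≤ h → ¬ (triangle a′ % p ≡ triangle a % p)
  triangle-distinct {a} {a′} a<a′ a′≤h e with a′ ℕ.∸ suc a | ℕ.m+[n∸m]≡n a<a′
  ... | d | refl = excluded (euclidsLemma (suc d) (suc d ℕ.+ (a ℕ.+ suc a)) p-prime
      (subst (p ∣_) (product a d (choose₂ (suc d)) (double (suc d)))
        (∣n⇒∣m*n 2 (%≡⇒∣ (triangle a) _ (trans (cong (_% p) difference) e)))))
    where
    double : ∀ k → 2 ℕ.* choose₂ k ℕ.+ k ≡ k ℕ.* k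
    double zero    = refl
    double (suc k) = trans (regroup k (choose₂ k)) (trans (cong (ℕ._+ suc (2 ℕ.* k)) (double k)) (square k))
      where
      regroup : ∀ k s → 2 ℕ.* (k ℕ.+ s) ℕ.+ suc k ≡ 2 ℕ.* s ℕ.+ k ℕ.+ suc (2 ℕ.* k)
      regroup = ℕ.solve-∀
      square : ∀ k → k ℕ.* k ℕ.+ suc (2 ℕ.* k) ≡ suc k ℕ.* suc k
      square = ℕ.solve-∀
    difference : triangle a ℕ.+ (choose₂ (suc d) ℕ.+ suc a ℕ.* suc d) ≡ triangle (suc a ℕ.+ d)
    difference = trans (sym (ℕ.+-assoc (triangle a) _ _)) (trans (sym (Triangles.choose₂-+ (suc a) (suc d))) (cong choose₂ (ℕ.+-suc (suc a) d)))
    product : ∀ a d s → 2 ℕ.* s ℕ.+ suc d ≡ suc d ℕ.* suc d → 2 ℕ.* (s ℕ.+ suc a ℕ.* suc d) ≡ suc d ℕ.* (suc d ℕ.+ (a ℕ.+ suc a))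
    product a d s e = trans (expand a d s) (trans (cong (ℕ._+ suc d ℕ.* (a ℕ.+ suc a)) e) (collect a d))
      where
      expand : ∀ a d s → 2 ℕ.* (s ℕ.+ suc a ℕ.* suc d) ≡ 2 ℕ.* s ℕ.+ suc d ℕ.+ suc d ℕ.* (a ℕ.+ suc a)
      expand = ℕ.solve-∀
      collect : ∀ a d → suc d ℕ.* suc d ℕ.+ suc d ℕ.* (a ℕ.+ suc a) ≡ suc d ℕ.* (suc d ℕ.+ (a ℕ.+ suc a))
      collect = ℕ.solve-∀
    1+a+d≤h : suc (a ℕ.+ d) ℕ.≤ h
    1+a+d≤h = a′≤h
    excluded : ¬ (p ∣ suc d ⊎ p ∣ suc d ℕ.+ (a ℕ.+ suc a))
    excluded (inj₁ p∣) = >⇒∤ (s≤s (ℕ.≤-trans (ℕ.≤-trans (s≤s (ℕ.m≤n+m d a)) 1+a+d≤h) (ℕ.m≤m+n h _))) p∣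
    excluded (inj₂ p∣) = >⇒∤ (s≤s (ℕ.≤-trans (ℕ.≤-trans (ℕ.m≤m+n _ d) (ℕ.≤-reflexive (twice a d))) (ℕ.*-monoʳ-≤ 2 1+a+d≤h))) p∣
      where
      twice : ∀ a d → suc d ℕ.+ (a ℕ.+ suc a) ℕ.+ d ≡ 2 ℕ.* suc (a ℕ.+ d)
      twice = ℕ.solve-∀

  module _ (n : ℕ) where
    K : ℕ
    K = n ℕ.+ p
    private module R = Ring (truncated K)

    -- At n and n + p only the classes a < A with triangle a ≡ n (mod p) contribute, and there is at most one.
    Coherent : ℕ → Series → Set
    Coherent A f = (f n ≡ + 0 × f K ≡ + 0) ⊎
      ∃[ a ] (a ℕ.< A × n % p ≡ triangle a % p × + 0 ≤ sign a * f n × + 0 ≤ sign a * f K)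

    -- If n lies in the class of `A`, then by `triangle-distinct` no earlier class has contributed,
    -- and `A` becomes the witness. Otherwise g vanishes at both exponents, because n + p has the
    -- residue of n.
    Coherent-+ : ∀ {A f g} → A ℕ.≤ h → Coherent A f → SeriesInClass K (triangle A) (sign A) g →
                 Coherent (suc A) (f R.+ g)
    Coherent-+ {A} {f} {g} A≤h cf cg with cg (ℕ.m≤m+n n p) | cg ℕ.≤-refl
    ... | gn , sn | gK , sK with n % p ℕ.≟ triangle A % p
    Coherent-+ {A} {f} {g} A≤h (inj₁ (fn≡0 , fK≡0)) cg | gn , sn | gK , sK | yes e =
      inj₂ (A , ℕ.≤-refl , e , subst (λ x → + 0 ≤ sign A * x) (sym (trans (cong (_+ g n) fn≡0) (ℤ.+-identityˡ (g n)))) sn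
                             , subst (λ x → + 0 ≤ sign A * x) (sym (trans (cong (_+ g K) fK≡0) (ℤ.+-identityˡ (g K)))) sK)
    Coherent-+ A≤h (inj₂ (a , a<A , e′ , _)) cg | _ | _ | yes e =
      contradiction (trans (sym e) e′) (triangle-distinct a<A A≤h)
    Coherent-+ {A} {f} {g} A≤h cf cg | gn , sn | gK , sK | no ≢ = extend cf
      where
      gn≡0 : f n + g n ≡ f n
      gn≡0 = trans (cong (λ x → f n + x) (fromInj gn)) (ℤ.+-identityʳ (f n))
        where
        fromInj : g n ≡ + 0 ⊎ n % p ≡ triangle A % p → g n ≡ + 0
        fromInj (inj₁ z) = z
        fromInj (inj₂ e) = contradiction e ≢
      gK≡0 : f K + g K ≡ f K
      gK≡0 = trans (cong (λ x → f K + x) (fromInj gK)) (ℤ.+-identityʳ (f K))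
        where
        fromInj : g K ≡ + 0 ⊎ K % p ≡ triangle A % p → g K ≡ + 0
        fromInj (inj₁ z) = z
        fromInj (inj₂ e) = contradiction (trans (sym ([m+n]%n≡m%n n p)) e) ≢
      extend : Coherent A f → Coherent (suc A) (f R.+ g)
      extend (inj₁ (fn≡0 , fK≡0)) = inj₁ (trans gn≡0 fn≡0 , trans gK≡0 fK≡0)
      extend (inj₂ (a , a<A , e , pn , pK)) = inj₂ (a , ℕ.m<n⇒m<1+n a<A , e ,
        subst (λ x → + 0 ≤ sign a * x) (sym gn≡0) pn , subst (λ x → + 0 ≤ sign a * x) (sym gK≡0) pK)

    Coherent-∑ : ∀ A {f} → A ℕ.≤ h → (∀ {a} → a ℕ.< A → SeriesInClass K (triangle a) (sign a) (f a)) → Coherent A (R.∑ A f)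
    Coherent-∑ zero    _   _  = inj₁ (refl , refl)
    Coherent-∑ (suc A) {f} A<h cf = Coherent-+ {A} {R.∑ A f} {f A} (ℕ.<⇒≤ A<h) (Coherent-∑ A (ℕ.<⇒≤ A<h) λ a<A → cf (ℕ.m<n⇒m<1+n a<A)) (cf ℕ.≤-refl)

    Coherent⇒0≤ : ∀ {A f} → Coherent A f → + 0 ≤ f n * f K
    Coherent⇒0≤ {f = f} (inj₁ (fn≡0 , _)) = ℤ.≤-reflexive (sym (trans (cong (_* f K) fn≡0) (ℤ.*-zeroˡ (f K))))
    Coherent⇒0≤ (inj₂ (a , _ , _ , pn , pK)) = same-sign a pn pK

    Coherent-resp : ∀ {A f g} → f R.≈ g → Coherent A f → Coherent A g
    Coherent-resp e (inj₁ (fn≡0 , fK≡0)) = inj₁ (trans (sym (e (ℕ.m≤m+n n p))) fn≡0 , trans (sym (e ℕ.≤-refl)) fK≡0)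
    Coherent-resp e (inj₂ (a , a<A , r , pn , pK)) = inj₂ (a , a<A , r ,
      subst (λ x → + 0 ≤ sign a * x) (e (ℕ.m≤m+n n p)) pn , subst (λ x → + 0 ≤ sign a * x) (e ℕ.≤-refl) pK)

    P-q^p : SeriesInClass K 0 (+ 1) (q R.^ p)
    P-q^p = SeriesInClass-mod K {f = q R.^ p} (n%n≡0 p) (SeriesInClass-q^ K p)

    inverse : ∀ m → geom m R.* (R.1# R.- (q R.^ p) R.^ suc m) R.≈ R.1#
    inverse m = R.trans (R.*-congˡ {geom m} (R.+-congˡ {R.1#} (R.-‿cong (R.^-assocʳ q p (suc m))))) (geom-inverse K m)

    P-geom : ∀ m → SeriesInClass K 0 (+ 1) (geom m)
    P-geom m = geomQ-InClass K (divides (suc m) (ℕ.*-comm p (suc m)))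

    open Jacobi (truncated K) using (euler-function)
    open Positivity (truncated K) (nonNegative K) using (dissection; Summand)

    Summand⇒InClass : ∀ {a f} → Summand q geom (suc K) (Truncated.q^-nilpotent K) a f → SeriesInClass K (triangle a) (sign a) f
    Summand⇒InClass {a} {f} (S , PS , e) = SeriesInClass-resp K (R.sym {f} e) (SeriesInClass-shift K a (triangle a) PS)

    ∑-coherent : ∀ {s m} → (∀ {a} → a ℕ.< h → Summand q geom (suc K) (Truncated.q^-nilpotent K) a (s a)) →
      Summand q geom (suc K) (Truncated.q^-nilpotent K) h m → Coherent (suc h) (R.∑ h s R.+ m)
    ∑-coherent {s} {m} cs cm = Coherent-+ {h} {R.∑ h s} {m} ℕ.≤-refl
      (Coherent-∑ h {s} ℕ.≤-refl λ {a} a<h → Summand⇒InClass {a} {s a} (cs a<h)) (Summand⇒InClass {h} {m} cm)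

    partialProd-coherent : ∀ N → suc (suc K ℕ.+ suc K) ℕ.≤ N → Coherent (suc h) (partialProd p (p ℕ.* N))
    partialProd-coherent N big = combine (dissection q geom (suc K) (Truncated.q^-nilpotent K) P-geom h N P-q^p inverse big)
      where
      F G : Series
      F = partialProd p (p ℕ.* N)
      G = R.cube# (euler-function q (p ℕ.* N)) R.* R.cube# (R.∏ (p ℕ.* N) geom)
      combine : ∃[ s ] ∃[ m ] ((∀ {a} → a ℕ.< h → Summand q geom (suc K) (Truncated.q^-nilpotent K) a (s a)) ×
                  Summand q geom (suc K) (Truncated.q^-nilpotent K) h m × G R.≈ R.∑ h s R.+ m) → Coherent (suc h) F
      combine (s , m , cs , cm , e) = Coherent-resp {suc h} {R.∑ h s R.+ m} {F}
        (R.sym {F} {R.∑ h s R.+ m} (R.trans {F} {G} {R.∑ h s R.+ m} (partialProd≈ K (p ℕ.* N)) e)) (∑-coherent {s} {m} cs cm)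

    c3-same-sign : + 0 ≤ c3 p n * c3 p (n ℕ.+ p)
    -- This is the bound 2L + 1 of `triple-product`, with L = K + 1 the exponent at which `q`
    -- becomes nilpotent.
    c3-same-sign = conclude (suc (suc K ℕ.+ suc K)) ℕ.≤-refl
      where
      conclude : ∀ N → suc (suc K ℕ.+ suc K) ℕ.≤ N → + 0 ≤ c3 p n * c3 p (n ℕ.+ p)
      conclude N big = subst (+ 0 ≤_) (sym (cong₂ _*_ (c3≡ (ℕ.≤-trans (ℕ.m≤m+n n p) K≤pN)) (c3≡ K≤pN)))
        (Coherent⇒0≤ {suc h} {partialProd p (p ℕ.* N)} (partialProd-coherent N big))
        where
        K≤pN : K ℕ.≤ p ℕ.* N
        K≤pN = ℕ.≤-trans (ℕ.≤-trans (ℕ.≤-trans (ℕ.n≤1+n K) (ℕ.≤-trans (ℕ.m≤m+n (suc K) (suc K)) (ℕ.n≤1+n _))) big) (ℕ.m≤m+n N _)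

even-or-odd : ∀ n → (∃[ h ] n ≡ 2 ℕ.* h) ⊎ (∃[ h ] n ≡ suc (2 ℕ.* h))
even-or-odd zero = inj₁ (0 , refl)
even-or-odd (suc n) with even-or-odd n
... | inj₁ (h , refl) = inj₂ (h , refl)
... | inj₂ (h , refl) = inj₁ (suc h , sym (ℕ.*-suc 2 h))

theorem1p9 : (p : ℕ) → Prime p → (n : ℕ) →
    + 0 ≤ c3 p n * c3 p (n Data.Nat.+ p)
theorem1p9 p p-prime n with even-or-odd p
... | inj₂ (h , refl) = OddPrime.c3-same-sign h p-prime n
-- Since 2 divides p, either 2 = 1, which the coverage check discards, or 2 = p.
... | inj₁ (h , refl) with prime⇒irreducible p-prime (divides h (ℕ.*-comm 2 h))
...   | inj₂ e = subst (λ p → + 0 ≤ c3 p n * c3 p (n ℕ.+ p)) e (EvenPrime.c3-same-sign n)
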